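{- Let $n\geqslant 1$ and $m\in\{\bullet,\circ\}^n$. Then $$w(m)=\sum_{\substack{T \text{ staircase tableau of size } n\\ \mathrm{type}(T)=m}} w(T).$$
   Context: Weight of words (with the convention $u=1$): $w:\{\bullet,\circ\}^*\to\mathbb{Z}[\alpha,\beta,\gamma,\delta,q]$ is defined recursively by $w(\varepsilon)=1$ and, for every word $X$ of length $n\geqslant 0$, $$w(\bullet X)=\alpha\delta\sum_{X=U\bullet V}q^{|\circ(U)|+|V|}\big(w(U\bullet V)+w(U\circ V)\big)+q^n\delta\,w(X)+q^{|\circ(X)|}\alpha\,w(X)+\alpha\beta\sum_{X=U\circ V}q^{|\circ(U)|}\big(w(U\bullet V)+w(U\circ V)\big),$$ $$w(\circ X)=\gamma\delta\sum_{X=U\bullet V}q^{|\circ(U)|+|V|}\big(w(U\bullet V)+w(U\circ V)\big)+q^{|\circ(X)|}\gamma\,w(X)+\gamma\beta\sum_{X=U\circ V}q^{|\circ(U)|}\big(w(U\bullet V)+w(U\circ V)\big)+\beta\,w(X).$$ Here $\varepsilon$ is the empty word, $|X|$ is the length and $|\circ(X)|$ the number of letters $\circ$ of $X$, and $\sum_{X=U\bullet V}$ (resp. $\sum_{X=U\circ V}$) runs over all factorizations of $X$ around an occurrence of $\bullet$ (resp. $\circ$). (This is the solution $h^{\lambda}$ of the generalized matrix ansatz of Derrida–Evans–Hakim–Pasquier/Corteel–Williams for $\lambda_0=1$, $\lambda_k=u^{k-1}\alpha\beta-q^{k-1}\gamma\delta$, specialized at $u=1$.) Staircase tableaux: for $n\geqslant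 1$, the staircase shape of size $n$ is the set of cells $(i,j)$, $1\leqslant j\leqslant i\leqslant n$, rows numbered bottom to top and columns left to right (row $i$ is $(i,1),\dots,(i,i)$; column $j$ is $(j,j),\dots,(n,j)$ bottom to top); $c_i=(i,i)$. A staircase tableau of size $n$ is a filling in which each cell is empty or labelled by one of $\alpha,\beta,\gamma,\delta$ such that every $c_i$ is labelled, all cells above (same column) a cell labelled $\alpha$ or $\gamma$ are empty, and all cells to the left (same row) of a cell labelled $\beta$ or $\delta$ are empty. Its type is $m_n\cdots m_1$ with $m_i=\bullet$ if $c_i\in\{\alpha,\delta\}$ and $m_i=\circ$ if $c_i\in\{\beta,\gamma\}$. Weight (with $u=1$): an empty cell $e$ receives $q$ if the nearest labelled cell to its right in its row is labelled $\delta$, or if that cell is labelled $\alpha$ or $\gamma$ and the nearest labelled cell below $e$ in its column is labelled $\beta$ or $\gamma$; otherwise it receives $1$. $w(T)$ is the product of all labels times $q^N$, $N$ the number of empty cells receiving $q$. -}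

module Defs where

open import Data.Nat using (ℕ; zero; suc; _+_; _∸_; _≡ᵇ_)
import Data.Nat as ℕ
open import Data.Bool using (Bool; true; false; _∧_; not; if_then_else_)
open import Data.List.Base using (List; []; _∷_; _++_; map; foldr; length; concatMap; upTo; reverse)
open import Data.Vec using (Vec; []; _∷_; toList)
open import Data.Maybe using (Maybe; just; nothing)
open import Data.Product using (_×_; _,_)
open import Algebra.Bundles using (CommutativeRing)

data Letter : Set where
  ● ○ : Letter

_==L_ : Letter → Letter → Bool
● ==L ● = true
○ ==L ○ = true
_ ==L _ = false

_==W_ : List Letter → List Letter → Bool
[] ==W [] = true
(a ∷ X) ==W (b ∷ Y) = (a ==L b) ∧ (X ==W Y)
_ ==W _ = false

countCirc : List Letter → ℕ
countCirc [] = 0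
countCirc (● ∷ X) = countCirc X
countCirc (○ ∷ X) = suc (countCirc X)

splitsAround : Letter → List Letter → List (List Letter × List Letter)
splitsAround a [] = []
splitsAround a (b ∷ X) =
  let rest = map (λ { (U , V) → (b ∷ U , V) }) (splitsAround a X)
  in if a ==L b then ([] , X) ∷ rest else rest

all : {A : Set} → (A → Bool) → List A → Bool
all p [] = true
all p (x ∷ xs) = p x ∧ all p xs

range : ℕ → ℕ → List ℕ
range a b = map (a +_) (upTo (suc b ∸ a))

data Label : Set where
  Lα Lβ Lγ Lδ : Label

-- Stair n : fillings of the staircase shape of size n.
-- A filling of size (suc n) is a filling of size n (rows 1..n) together
-- with its top row n+1, whose entry k (0-based) is cell (n+1, k+1).
-- nothing = empty cell, just ℓ = cell labelled ℓ.
data Stair : ℕ → Set where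
  [] : Stair 0
  _▷_ : ∀ {n} → Stair n → Vec (Maybe Label) (suc n) → Stair (suc n)

nth : List (Maybe Label) → ℕ → Maybe Label
nth [] _ = nothing
nth (x ∷ _) zero = x
nth (_ ∷ xs) (suc k) = nth xs k

-- content of cell (i , j) (1-based: row i, column j); only meaningful
-- for 1 ≤ j ≤ i ≤ n
get : ∀ {n} → Stair n → ℕ → ℕ → Maybe Label
get [] _ _ = nothing
get {suc n} (T ▷ r) i j =
  if i ≡ᵇ suc n then nth (toList r) (j ∸ 1) else get T i j

allLabels : List (Maybe Label)
allLabels = nothing ∷ just Lα ∷ just Lβ ∷ just Lγ ∷ just Lδ ∷ []

allVec : (k : ℕ) → List (Vec (Maybe Label) k)
allVec zero = [] ∷ []
allVec (suc k) = concatMap (λ x → map (x ∷_) (allVec k)) allLabels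

allStair : (n : ℕ) → List (Stair n)
allStair zero = [] ∷ []
allStair (suc n) = concatMap (λ T → map (T ▷_) (allVec (suc n))) (allStair n)

isLab : Maybe Label → Bool
isLab nothing = false
isLab (just _) = true

isαγ : Maybe Label → Bool
isαγ (just Lα) = true
isαγ (just Lγ) = true
isαγ _ = false

isβδ : Maybe Label → Bool
isβδ (just Lβ) = true
isβδ (just Lδ) = true
isβδ _ = false

isβγ : Maybe Label → Bool
isβγ (just Lβ) = true
isβγ (just Lγ) = true
isβγ _ = false

isδ : Maybe Label → Bool
isδ (just Lδ) = true
isδ _ = false

cells : ℕ → List (ℕ × ℕ)
cells n = concatMap (λ i → map (i ,_) (range 1 i)) (range 1 n)

module _ {n : ℕ} (T : Stair n) where

  diagOK : Bool
  diagOK = all (λ i → isLab (get T i i)) (range 1 n)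

  colOK : Bool
  colOK = all (λ { (i , j) → if isαγ (get T i j)
                    then all (λ i' → not (isLab (get T i' j))) (range (suc i) n)
                    else true }) (cells n)

  rowOK : Bool
  rowOK = all (λ { (i , j) → if isβδ (get T i j)
                    then all (λ j' → not (isLab (get T i j'))) (range 1 (j ∸ 1))
                    else true }) (cells n)

  isStaircase : Bool
  isStaircase = diagOK ∧ colOK ∧ rowOK

  letterOf : Maybe Label → Letter
  letterOf (just Lα) = ●
  letterOf (just Lδ) = ●
  letterOf _ = ○

  -- type(T) = m_n ⋯ m_1, as a list whose head is m_n
  type : List Letter
  type = map (λ i → letterOf (get T i i)) (reverse (range 1 n))

nearest : List (Maybe Label) → Maybe Label
nearest [] = nothing
nearest (just ℓ ∷ _) = just ℓ
nearest (nothing ∷ xs) = nearest xs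

module _ {n : ℕ} (T : Stair n) where

  rightOf : ℕ → ℕ → Maybe Label
  rightOf i j = nearest (map (λ j' → get T i j') (range (suc j) i))

  belowOf : ℕ → ℕ → Maybe Label
  belowOf i j = nearest (map (λ i' → get T i' j) (reverse (range j (i ∸ 1))))

  receivesQ : ℕ → ℕ → Bool
  receivesQ i j = if isδ (rightOf i j) then true
                  else (if isαγ (rightOf i j) then isβγ (belowOf i j) else false)

-- Evaluation in an arbitrary commutative ring at α β γ δ q
-- (an identity in ℤ[α,β,γ,δ,q] is the same as an identity holding in
-- every commutative ring for all values of the variables)

module Weights {c ℓ} (R : CommutativeRing c ℓ)
               (α β γ δ q : CommutativeRing.Carrier R) where
  open CommutativeRing R hiding (_+_)
  open CommutativeRing R using () renaming (_+_ to _⊕_)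

  pow : Carrier → ℕ → Carrier
  pow x zero = 1#
  pow x (suc k) = x * pow x k

  sumL : List Carrier → Carrier
  sumL = foldr _⊕_ 0#

  prodL : List Carrier → Carrier
  prodL = foldr _*_ 1#

  wF : ℕ → List Letter → Carrier
  wF zero _ = 1#
  wF (suc k) [] = 1#
  wF (suc k) (● ∷ X) =
      (α * δ) * sumL (map (λ { (U , V) → pow q (countCirc U ℕ.+ length V)
                               * (wF k (U ++ ● ∷ V) ⊕ wF k (U ++ ○ ∷ V)) })
                          (splitsAround ● X))
    ⊕ pow q (length X) * δ * wF k X
    ⊕ pow q (countCirc X) * α * wF k X
    ⊕ (α * β) * sumL (map (λ { (U , V) → pow q (countCirc U)
                               * (wF k (U ++ ● ∷ V) ⊕ wF k (U ++ ○ ∷ V)) })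
                          (splitsAround ○ X))
  wF (suc k) (○ ∷ X) =
      (γ * δ) * sumL (map (λ { (U , V) → pow q (countCirc U ℕ.+ length V)
                               * (wF k (U ++ ● ∷ V) ⊕ wF k (U ++ ○ ∷ V)) })
                          (splitsAround ● X))
    ⊕ pow q (countCirc X) * γ * wF k X
    ⊕ (γ * β) * sumL (map (λ { (U , V) → pow q (countCirc U)
                               * (wF k (U ++ ● ∷ V) ⊕ wF k (U ++ ○ ∷ V)) })
                          (splitsAround ○ X))
    ⊕ β * wF k X

  w : List Letter → Carrier
  w X = wF (length X) X

  labelVal : Label → Carrier
  labelVal Lα = α
  labelVal Lβ = β
  labelVal Lγ = γ
  labelVal Lδ = δ

  cellWeight : ∀ {n} → Stair n → ℕ × ℕ → Carrier
  cellWeight T (i , j) with get T i j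
  ... | just ℓ′ = labelVal ℓ′
  ... | nothing = if receivesQ T i j then q else 1#

  wT : ∀ {n} → Stair n → Carrier
  wT {n} T = prodL (map (cellWeight T) (cells n))

  tableauSum : (n : ℕ) → List Letter → Carrier
  tableauSum n m = sumL (map (λ T → if isStaircase T ∧ (type T ==W m)
                                     then wT T else 0#) (allStair n))

{-# OPTIONS --safe #-}
module Submission where

-- Build a tableau row by row from the bottom and remember, for each column, only
-- its topmost label. A new row is read from right to left; it depends on the
-- tableau below only through these labels, so the tableaux of type m are counted
-- by a vector Φ(m) in V^⊗n with V = ⟨α, β, γ, δ⟩. With R the operator adding the
-- part of a row to the left of a diagonal α or γ,
--   Φ(●X) = α e_α ⊗ R Φ(X) + δ q^n e_δ ⊗ Φ(X),
--   Φ(○X) = γ e_γ ⊗ R Φ(X) + β e_β ⊗ Φ(X).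
-- Let S be the linear operator on words
--   S(X) = q^|○(X)| X + δ Σ_{X=U●V} q^(|○(U)|+|V|) (U●V + U○V) + β Σ_{X=U○V} q^|○(U)| (U●V + U○V),
-- so that w(●X) = α w(S X) + δ q^n w(X) and w(○X) = γ w(S X) + β w(X). An
-- induction on X gives Φ(S X) = R Φ(X), hence the sum of the coordinates of Φ
-- satisfies the recursion of w.

open import Defs
open import Algebra.Bundles using (CommutativeRing)
import Algebra.Solver.Ring.NaturalCoefficients.Default as Solver
open import Data.Bool using (Bool; true; false; _∧_; not; if_then_else_)
open import Data.Bool.Properties using (∧-conicalˡ; ∧-conicalʳ; ⇔→≡; ∧-zeroʳ)
open import Data.List.Base using (List; []; _∷_; _++_; [_]; map; upTo; applyUpTo; reverse; concatMap; length; drop)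
open import Data.List.Membership.Propositional using (_∈_; find; lose)
open import Data.List.Membership.Propositional.Properties using (∈-map⁺; ∈-map⁻; ∈-upTo⁺; ∈-upTo⁻; ∈-concatMap⁺; ∈-concatMap⁻)
open import Data.List.Properties using (map-++; map-∘; map-cong; map-cong-local; upTo-∷ʳ; map-upTo; reverse-++; concatMap-++; ++-identityʳ)
open import Data.List.Relation.Unary.All using (tabulate)
open import Data.List.Relation.Unary.Any using (here; there)
open import Data.List.Relation.Unary.Any.Properties using (reverse⁻)
open import Data.Maybe using (Maybe; just; nothing; _<∣>_)
open import Data.Maybe.Properties using (<∣>-identityʳ)
open import Data.Nat using (ℕ; zero; suc; _+_; _∸_; _≤_; _<_; z≤n; s≤s; s≤s⁻¹; _≡ᵇ_)
open import Data.Nat.Properties using (≤-refl; ≤-trans; <⇒≤; m≤m+n; m+[n∸m]≡n; m≤n⇒m≤1+n; ∸-monoˡ-<; +-∸-assoc; m≤n⇒m<n∨m≡n; m≤n⇒m∸n≡0; <-≤-trans; _≤?_; ≰⇒>; m∸n≤m; ∸-monoˡ-≤)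
open import Data.Product using (_×_; _,_; proj₁; proj₂; ∃)
open import Data.Sum using (_⊎_; inj₁; inj₂)
open import Data.Vec using (Vec; []; _∷_; _∷ʳ_; toList; zipWith; initLast)
open import Data.Vec.Properties using (length-toList)
open import Function using (_∘_; mk⇔)
open import Relation.Binary.PropositionalEquality using (_≡_; refl; sym; trans; cong; cong₂; subst; module ≡-Reasoning)
open import Relation.Nullary using (yes; no)
import Relation.Binary.Reasoning.Setoid as ≈-Reasoning

private
  variable
    A B : Set
    n : ℕ

-- Boolean tests, integer ranges and the cells of the shape.

Cell : Set
Cell = Maybe Label

all⁺ : ∀ {p : A → Bool} xs → (∀ {x} → x ∈ xs → p x ≡ true) → all p xs ≡ true
all⁺ []       h = refl
all⁺ (x ∷ xs) h = cong₂ _∧_ (h (here refl)) (all⁺ xs (h ∘ there))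

all⁻ : ∀ {p : A → Bool} {x} xs → all p xs ≡ true → x ∈ xs → p x ≡ true
all⁻ {p = p} (y ∷ xs) h (here refl) = ∧-conicalˡ (p y) _ h
all⁻ {p = p} (y ∷ xs) h (there x∈)  = all⁻ xs (∧-conicalʳ (p y) _ h) x∈

map-cong-∈ : ∀ {a b} {A : Set a} {B : Set b} {f g : A → B} xs → (∀ {x} → x ∈ xs → f x ≡ g x) → map f xs ≡ map g xs
map-cong-∈ xs h = map-cong-local (tabulate h)

if-true⁺ : ∀ b {c} → (b ≡ true → c ≡ true) → (if b then c else true) ≡ true
if-true⁺ true  h = h refl
if-true⁺ false h = refl

if-true⁻ : ∀ {b c} → (if b then c else true) ≡ true → b ≡ true → c ≡ true
if-true⁻ h refl = h

not-true⁺ : ∀ {b} → b ≡ false → not b ≡ true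
not-true⁺ refl = refl

not-true⁻ : ∀ {b} → not b ≡ true → b ≡ false
not-true⁻ {false} _ = refl

≡true-or-false : ∀ b → b ≡ true ⊎ b ≡ false
≡true-or-false true  = inj₁ refl
≡true-or-false false = inj₂ refl

∈-range⁻ : ∀ {a b x} → x ∈ range a b → a ≤ x × x ≤ b
∈-range⁻ {a} {b} x∈ with k , k∈ , refl ← ∈-map⁻ (a +_) x∈ = m≤m+n a k , bound a b (∈-upTo⁻ k∈)
  where
  bound : ∀ a b {k} → k < suc b ∸ a → a + k ≤ b
  bound zero    b       k<     = s≤s⁻¹ k<
  bound (suc a) (suc b) k<     = s≤s (bound a b k<)
  bound (suc a) zero    {k} k< with () ← subst (k <_) (m≤n⇒m∸n≡0 {0} {a} z≤n) k<

∈-range⁺ : ∀ {a b x} → a ≤ x → x ≤ b → x ∈ range a b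
∈-range⁺ {a} {b} a≤x x≤b =
  subst (_∈ range a b) (m+[n∸m]≡n a≤x) (∈-map⁺ (a +_) (∈-upTo⁺ (∸-monoˡ-< (s≤s x≤b) a≤x)))

range-∷ʳ : ∀ {a b} → a ≤ suc b → range a (suc b) ≡ range a b ++ [ suc b ]
range-∷ʳ {a} {b} a≤ = begin
  map (a +_) (upTo (suc (suc b) ∸ a))             ≡⟨ cong (map (a +_) ∘ upTo) (+-∸-assoc 1 a≤) ⟩
  map (a +_) (upTo (suc (suc b ∸ a)))             ≡⟨ cong (map (a +_)) (upTo-∷ʳ (suc b ∸ a)) ⟨
  map (a +_) (upTo (suc b ∸ a) ++ [ suc b ∸ a ])  ≡⟨ map-++ (a +_) (upTo (suc b ∸ a)) _ ⟩
  range a b ++ [ a + (suc b ∸ a) ]                ≡⟨ cong (λ k → range a b ++ [ k ]) (m+[n∸m]≡n a≤) ⟩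
  range a b ++ [ suc b ]                          ∎
  where open ≡-Reasoning

range-empty : ∀ {a b} → b < a → range a b ≡ []
range-empty {a} b<a = cong (map (a +_) ∘ upTo) (m≤n⇒m∸n≡0 b<a)

∈-cells⁻ : ∀ {i j} → (i , j) ∈ cells n → 1 ≤ j × j ≤ i × i ≤ n
∈-cells⁻ {n} c∈
  with i , i∈ , c∈row ← find (∈-concatMap⁻ (λ i → map (i ,_) (range 1 i)) {xs = range 1 n} c∈)
  with j , j∈ , refl ← ∈-map⁻ (i ,_) c∈row
  = proj₁ (∈-range⁻ {1} j∈) , proj₂ (∈-range⁻ {1} j∈) , proj₂ (∈-range⁻ {1} i∈)

∈-cells⁺ : ∀ {i j} → 1 ≤ j → j ≤ i → i ≤ n → (i , j) ∈ cells n
∈-cells⁺ {i = i} 1≤j j≤i i≤n =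
  ∈-concatMap⁺ (λ i → map (i ,_) (range 1 i))
    (lose (∈-range⁺ {1} (≤-trans 1≤j j≤i) i≤n) (∈-map⁺ (i ,_) (∈-range⁺ 1≤j j≤i)))

cells-suc : ∀ n → cells (suc n) ≡ cells n ++ map (suc n ,_) (range 1 (suc n))
cells-suc n = begin
  concatMap row (range 1 (suc n))           ≡⟨ cong (concatMap row) (range-∷ʳ {1} {n} (s≤s z≤n)) ⟩
  concatMap row (range 1 n ++ [ suc n ])    ≡⟨ concatMap-++ row (range 1 n) _ ⟩
  cells n ++ (row (suc n) ++ [])            ≡⟨ cong (cells n ++_) (++-identityʳ (row (suc n))) ⟩
  cells n ++ row (suc n)                    ∎
  where
  open ≡-Reasoning
  row : ℕ → List (ℕ × ℕ)
  row i = map (i ,_) (range 1 i)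

-- Entries of rows and topmost labels of columns.

nth-∷ʳ-nothing : ∀ (xs : Vec Cell n) j → nth (toList (xs ∷ʳ nothing)) j ≡ nth (toList xs) j
nth-∷ʳ-nothing []       zero    = refl
nth-∷ʳ-nothing []       (suc j) = refl
nth-∷ʳ-nothing (x ∷ xs) zero    = refl
nth-∷ʳ-nothing (x ∷ xs) (suc j) = nth-∷ʳ-nothing xs j

nth-∷ʳ-last : ∀ (xs : Vec Cell n) x → nth (toList (xs ∷ʳ x)) n ≡ x
nth-∷ʳ-last []       x = refl
nth-∷ʳ-last (_ ∷ xs) x = nth-∷ʳ-last xs x

nth-≥ : ∀ (xs : Vec Cell n) {j} → n ≤ j → nth (toList xs) j ≡ nothing
nth-≥ []       _         = refl
nth-≥ (_ ∷ xs) (s≤s n≤j) = nth-≥ xs n≤j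

nth-zipWith-<∣> : ∀ (xs ys : Vec Cell n) j →
  nth (toList (zipWith _<∣>_ xs ys)) j ≡ nth (toList xs) j <∣> nth (toList ys) j
nth-zipWith-<∣> []       []       j       = refl
nth-zipWith-<∣> (x ∷ xs) (y ∷ ys) zero    = refl
nth-zipWith-<∣> (x ∷ xs) (y ∷ ys) (suc j) = nth-zipWith-<∣> xs ys j

zipWith-∷ʳ : ∀ (f : A → A → A) (xs ys : Vec A n) x y →
  zipWith f (xs ∷ʳ x) (ys ∷ʳ y) ≡ zipWith f xs ys ∷ʳ f x y
zipWith-∷ʳ f []       []       x y = refl
zipWith-∷ʳ f (a ∷ xs) (b ∷ ys) x y = cong (f a b ∷_) (zipWith-∷ʳ f xs ys x y)

≡ᵇ-refl : ∀ n → (n ≡ᵇ n) ≡ true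
≡ᵇ-refl zero    = refl
≡ᵇ-refl (suc n) = ≡ᵇ-refl n

<⇒≡ᵇ-false : ∀ {i n} → i < n → (i ≡ᵇ n) ≡ false
<⇒≡ᵇ-false {zero}  (s≤s _)   = refl
<⇒≡ᵇ-false {suc i} (s≤s i<n) = <⇒≡ᵇ-false i<n

get-top : ∀ (T : Stair n) r j → get (T ▷ r) (suc n) j ≡ nth (toList r) (j ∸ 1)
get-top {n} T r j rewrite ≡ᵇ-refl n = refl

get-old : ∀ (T : Stair n) r {i} j → i ≤ n → get (T ▷ r) i j ≡ get T i j
get-old T r j i≤n rewrite <⇒≡ᵇ-false (s≤s i≤n) = refl

-- Entry k is the topmost label of column k+1.
tops : Stair n → Vec Cell n
tops []      = []
tops (T ▷ r) = zipWith _<∣>_ r (tops T ∷ʳ nothing)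

nth-tops-▷ : ∀ (T : Stair n) r j →
  nth (toList (tops (T ▷ r))) j ≡ nth (toList r) j <∣> nth (toList (tops T)) j
nth-tops-▷ T r j = trans (nth-zipWith-<∣> r (tops T ∷ʳ nothing) j)
                         (cong (nth (toList r) j <∣>_) (nth-∷ʳ-nothing (tops T) j))

nearest-∷ : ∀ x xs → nearest (x ∷ xs) ≡ x <∣> nearest xs
nearest-∷ nothing  xs = refl
nearest-∷ (just _) xs = refl

reverse-range-suc : ∀ {a b} → a ≤ suc b → reverse (range a (suc b)) ≡ suc b ∷ reverse (range a b)
reverse-range-suc {a} {b} a≤ = trans (cong reverse (range-∷ʳ a≤)) (reverse-++ (range a b) _)

-- The newest row comes first in the reversed range, which matches the recursion of `tops`: a label
-- there hides the column below, an empty entry exposes it. Past the last column the range is empty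
-- and `nth` has run off the vector, so both sides are `nothing`.
nearest-column : ∀ (T : Stair n) j →
  nearest (map (λ i → get T i (suc j)) (reverse (range (suc j) n))) ≡ nth (toList (tops T)) j
nearest-column []          j rewrite range-empty {suc j} {0} (s≤s z≤n) = refl
nearest-column {suc n} (T ▷ r) j with j ≤? n
... | yes j≤n = begin
  nearest (map (λ i → get (T ▷ r) i (suc j)) (reverse (range (suc j) (suc n))))
    ≡⟨ cong (nearest ∘ map _) (reverse-range-suc (s≤s j≤n)) ⟩
  nearest (get (T ▷ r) (suc n) (suc j) ∷ map (λ i → get (T ▷ r) i (suc j)) (reverse (range (suc j) n)))
    ≡⟨ cong₂ (λ x xs → nearest (x ∷ xs)) (get-top T r (suc j))
         (map-cong-∈ _ λ i∈ → get-old T r (suc j) (proj₂ (∈-range⁻ {suc j} (reverse⁻ i∈)))) ⟩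
  nearest (nth (toList r) j ∷ map (λ i → get T i (suc j)) (reverse (range (suc j) n)))
    ≡⟨ nearest-∷ (nth (toList r) j) _ ⟩
  nth (toList r) j <∣> nearest (map (λ i → get T i (suc j)) (reverse (range (suc j) n)))
    ≡⟨ cong (nth (toList r) j <∣>_) (nearest-column T j) ⟩
  nth (toList r) j <∣> nth (toList (tops T)) j
    ≡⟨ nth-tops-▷ T r j ⟨
  nth (toList (tops (T ▷ r))) j ∎
  where open ≡-Reasoning
... | no j≰n rewrite range-empty {suc j} {suc n} (s≤s (≰⇒> j≰n)) = sym (nth-≥ (tops (T ▷ r)) (≰⇒> j≰n))

-- Writing the top row as `r ∷ʳ x` exposes its diagonal cell `x`, whose letter is the head because
-- types list the rows from the top down. `letterOf` is indexed by a filling; its instances are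
-- compared through the one at `[]`.
type-▷ : ∀ (T : Stair n) r x → type (T ▷ (r ∷ʳ x)) ≡ letterOf [] x ∷ type T
type-▷ {n} T r x = begin
  map f (reverse (range 1 (suc n)))          ≡⟨ cong (map f) (reverse-range-suc {1} {n} (s≤s z≤n)) ⟩
  f (suc n) ∷ map f (reverse (range 1 n))    ≡⟨ cong₂ _∷_ (trans (cong (letterOf (T ▷ (r ∷ʳ x))) top) (letterOf-const (T ▷ (r ∷ʳ x)) x))
                                                 (map-cong-∈ _ old) ⟩
  letterOf [] x ∷ type T                      ∎
  where
  open ≡-Reasoning
  f : ℕ → Letter
  f i = letterOf (T ▷ (r ∷ʳ x)) (get (T ▷ (r ∷ʳ x)) i i)
  letterOf-const : ∀ {k} (S : Stair k) y → letterOf S y ≡ letterOf [] y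
  letterOf-const S nothing   = refl
  letterOf-const S (just Lα) = refl
  letterOf-const S (just Lβ) = refl
  letterOf-const S (just Lγ) = refl
  letterOf-const S (just Lδ) = refl
  top : get (T ▷ (r ∷ʳ x)) (suc n) (suc n) ≡ x
  top = trans (get-top T (r ∷ʳ x) (suc n)) (nth-∷ʳ-last r x)
  old : ∀ {i} → i ∈ reverse (range 1 n) → f i ≡ letterOf T (get T i i)
  old {i} i∈ = trans (letterOf-const (T ▷ (r ∷ʳ x)) _) (trans
    (cong (letterOf []) (get-old T (r ∷ʳ x) i (proj₂ (∈-range⁻ {1} (reverse⁻ i∈)))))
    (sym (letterOf-const T _)))

-- The staircase rules, row by row.

-- Columns and cells in a row are indexed from 0, rows from 1.
record Valid (T : Stair n) : Set where
  field
    diag : ∀ {j} → j < n → isLab (get T (suc j) (suc j)) ≡ true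
    col  : ∀ {i j i'} → j < i → i < i' → i' ≤ n →
           isαγ (get T i (suc j)) ≡ true → isLab (get T i' (suc j)) ≡ false
    row  : ∀ {i j j'} → i ≤ n → j < i → j' < j →
           isβδ (get T i (suc j)) ≡ true → isLab (get T i (suc j')) ≡ false

isStaircase⇒Valid : ∀ (T : Stair n) → isStaircase T ≡ true → Valid T
isStaircase⇒Valid {n} T h = record
  { diag = λ j<n → all⁻ (range 1 n) dg (∈-range⁺ {1} (s≤s z≤n) j<n)
  ; col  = λ j<i i<i' i'≤n lab →
      not-true⁻ (all⁻ (range _ n)
        (if-true⁻ (all⁻ (cells n) cl (∈-cells⁺ (s≤s z≤n) j<i (<⇒≤ (<-≤-trans i<i' i'≤n)))) lab)
        (∈-range⁺ i<i' i'≤n))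
  ; row  = λ i≤n j<i j'<j lab →
      not-true⁻ (all⁻ (range 1 _)
        (if-true⁻ (all⁻ (cells n) rw (∈-cells⁺ (s≤s z≤n) j<i i≤n)) lab)
        (∈-range⁺ {1} (s≤s z≤n) j'<j))
  }
  where
  dg = ∧-conicalˡ (diagOK T) _ h
  cl = ∧-conicalˡ (colOK T) _ (∧-conicalʳ (diagOK T) _ h)
  rw = ∧-conicalʳ (colOK T) _ (∧-conicalʳ (diagOK T) _ h)

Valid⇒isStaircase : ∀ (T : Stair n) → Valid T → isStaircase T ≡ true
Valid⇒isStaircase {n} T v = cong₂ _∧_ dg (cong₂ _∧_ cl rw)
  where
  open Valid v
  dg : diagOK T ≡ true
  dg = all⁺ (range 1 n) λ i∈ → dg′ (∈-range⁻ {1} i∈)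
    where
    dg′ : ∀ {i} → 1 ≤ i × i ≤ n → isLab (get T i i) ≡ true
    dg′ {suc j} (_ , j<n) = diag j<n
  cl : colOK T ≡ true
  cl = all⁺ (cells n) λ { {i , j} c∈ → if-true⁺ (isαγ (get T i j)) λ lab →
         all⁺ (range (suc i) n) λ i'∈ → not-true⁺ (cl′ (∈-cells⁻ c∈) (∈-range⁻ {suc i} i'∈) lab) }
    where
    cl′ : ∀ {i j i'} → 1 ≤ j × j ≤ i × i ≤ n → i < i' × i' ≤ n →
          isαγ (get T i j) ≡ true → isLab (get T i' j) ≡ false
    cl′ {j = suc j} (_ , j<i , _) (i<i' , i'≤n) = col j<i i<i' i'≤n
  rw : rowOK T ≡ true
  rw = all⁺ (cells n) λ { {i , j} c∈ → if-true⁺ (isβδ (get T i j)) λ lab →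
         all⁺ (range 1 (j ∸ 1)) λ j'∈ → not-true⁺ (rw′ (∈-cells⁻ c∈) (∈-range⁻ {1} j'∈) lab) }
    where
    rw′ : ∀ {i j j'} → 1 ≤ j × j ≤ i × i ≤ n → 1 ≤ j' × j' ≤ j ∸ 1 →
          isβδ (get T i j) ≡ true → isLab (get T i j') ≡ false
    rw′ {j = suc j} {suc j'} (_ , j<i , i≤n) (_ , j'<j) = row i≤n j<i j'<j

fits : Cell → Cell → Cell → Bool
fits nothing  s ρ = true
fits (just _) s ρ = not (isαγ s) ∧ not (isβδ ρ)

-- ss are the topmost labels of the columns below the row, ρ the nearest label to
-- the right of the given part of the row.
rowFits : Cell → Vec Cell n → Vec Cell n → Bool
rowFits ρ []      []       = true
rowFits ρ (x ∷ r) (s ∷ ss) = fits x s (nearest (toList r) <∣> ρ) ∧ rowFits ρ r ss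

-- The rules for one new row, stated for all pairs of cells; `rowFits` is the local form that looks
-- only at the nearest label.
RowValid : Vec Cell n → Vec Cell n → Set
RowValid r ss =
  (∀ j → isαγ (nth (toList ss) j) ≡ true → isLab (nth (toList r) j) ≡ false) ×
  (∀ {j' j} → j' < j → isβδ (nth (toList r) j) ≡ true → isLab (nth (toList r) j') ≡ false)

nearest-βδ : ∀ r → isβδ (nearest r) ≡ true → ∃ λ j → isβδ (nth r j) ≡ true
nearest-βδ (nothing ∷ r) h = let j , p = nearest-βδ r h in suc j , p
nearest-βδ (just _ ∷ r)  h = 0 , h

-- In a valid row the next label to the right of a label is α or γ, so only the
-- leftmost label can be β or δ.
fits-no-βδ : ∀ (r ss : Vec Cell n) → rowFits nothing r ss ≡ true →
  isβδ (nearest (toList r)) ≡ false → ∀ j → isβδ (nth (toList r) j) ≡ false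
fits-no-βδ []            []       h n₀ j       = refl
fits-no-βδ (nothing ∷ r) (s ∷ ss) h n₀ zero    = refl
fits-no-βδ (nothing ∷ r) (s ∷ ss) h n₀ (suc j) = fits-no-βδ r ss h n₀ j
fits-no-βδ (just x ∷ r)  (s ∷ ss) h n₀ zero    = n₀
fits-no-βδ (just x ∷ r)  (s ∷ ss) h n₀ (suc j) =
  fits-no-βδ r ss (∧-conicalʳ (not (isαγ s) ∧ _) _ h)
    (trans (cong isβδ (sym (<∣>-identityʳ (nearest (toList r)))))
           (not-true⁻ (∧-conicalʳ (not (isαγ s)) _ (∧-conicalˡ (not (isαγ s) ∧ _) _ h)))) j

absurd-bool : ∀ {b} {C : Set} → b ≡ true → b ≡ false → C
absurd-bool refl ()

rowFits⇒RowValid : ∀ (r ss : Vec Cell n) → rowFits nothing r ss ≡ true → RowValid r ss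
rowFits⇒RowValid []      []       h = (λ _ _ → refl) , λ _ _ → refl
rowFits⇒RowValid (x ∷ r) (s ∷ ss) h = cl x h , rw x h
  where
  tail : ∀ x → rowFits nothing (x ∷ r) (s ∷ ss) ≡ true → RowValid r ss
  tail x h = rowFits⇒RowValid r ss (∧-conicalʳ (fits x s _) _ h)
  cl : ∀ x → rowFits nothing (x ∷ r) (s ∷ ss) ≡ true → ∀ j →
       isαγ (nth (s ∷ toList ss) j) ≡ true → isLab (nth (x ∷ toList r) j) ≡ false
  cl x        h (suc j) p = proj₁ (tail x h) j p
  cl nothing  h zero    p = refl
  cl (just _) h zero    p =
    absurd-bool p (not-true⁻ (∧-conicalˡ (not (isαγ s)) _ (∧-conicalˡ (not (isαγ s) ∧ _) _ h)))
  rw : ∀ x → rowFits nothing (x ∷ r) (s ∷ ss) ≡ true → ∀ {j' j} → j' < j →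
       isβδ (nth (x ∷ toList r) j) ≡ true → isLab (nth (x ∷ toList r) j') ≡ false
  rw x        h {suc j'} {suc j} (s≤s j'<j) p = proj₂ (tail x h) j'<j p
  rw nothing  h {zero}   {suc j} _          p = refl
  rw (just _) h {zero}   {suc j} _          p =
    absurd-bool p (fits-no-βδ r ss (∧-conicalʳ (not (isαγ s) ∧ _) _ h)
      (trans (cong isβδ (sym (<∣>-identityʳ (nearest (toList r)))))
             (not-true⁻ (∧-conicalʳ (not (isαγ s)) _ (∧-conicalˡ (not (isαγ s) ∧ _) _ h)))) j)

RowValid⇒rowFits : ∀ (r ss : Vec Cell n) → RowValid r ss → rowFits nothing r ss ≡ true
RowValid⇒rowFits []      []       _         = refl
RowValid⇒rowFits (x ∷ r) (s ∷ ss) (cl , rw) =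
  cong₂ _∧_ (head x cl rw) (RowValid⇒rowFits r ss ((λ j → cl (suc j)) , λ j'<j → rw (s≤s j'<j)))
  where
  head : ∀ x → (∀ j → isαγ (nth (s ∷ toList ss) j) ≡ true → isLab (nth (x ∷ toList r) j) ≡ false) →
         (∀ {j' j} → j' < j → isβδ (nth (x ∷ toList r) j) ≡ true → isLab (nth (x ∷ toList r) j') ≡ false) →
         fits x s (nearest (toList r) <∣> nothing) ≡ true
  head nothing  cl rw = refl
  head (just _) cl rw = cong₂ _∧_ open-column open-row
    where
    open-column : not (isαγ s) ≡ true
    open-column with ≡true-or-false (isαγ s)
    ... | inj₁ p = absurd-bool refl (cl 0 p)
    ... | inj₂ p = not-true⁺ p
    open-row : not (isβδ (nearest (toList r) <∣> nothing)) ≡ true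
    open-row with ≡true-or-false (isβδ (nearest (toList r) <∣> nothing))
    ... | inj₂ p = not-true⁺ p
    ... | inj₁ p with j , q ← nearest-βδ (toList r) (trans (cong isβδ (sym (<∣>-identityʳ _))) p)
                 = absurd-bool refl (rw {0} {suc j} (s≤s z≤n) q)

-- A topmost label comes from some row: from the newest one if its entry is labelled, otherwise from
-- a row found by induction.
αγ-top⇒αγ-cell : ∀ (T : Stair n) j → isαγ (nth (toList (tops T)) j) ≡ true →
  ∃ λ i → j < i × i ≤ n × isαγ (get T i (suc j)) ≡ true
αγ-top⇒αγ-cell {suc n} (T ▷ r) j h = cases (nth (toList r) j) refl (trans (cong isαγ (sym (nth-tops-▷ T r j))) h)
  where
  cases : ∀ x → nth (toList r) j ≡ x → isαγ (x <∣> nth (toList (tops T)) j) ≡ true →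
          ∃ λ i → j < i × i ≤ suc n × isαγ (get (T ▷ r) i (suc j)) ≡ true
  cases (just x) eq p with j ≤? n
  ... | yes j≤n = suc n , s≤s j≤n , ≤-refl , trans (cong isαγ (trans (get-top T r (suc j)) eq)) p
  -- The index lies past the end of `r`, where `nth` yields `nothing`, so no label can be there.
  ... | no  j≰n with () ← trans (sym eq) (nth-≥ r (≰⇒> j≰n))
  cases nothing eq p with i , j<i , i≤n , q ← αγ-top⇒αγ-cell T j p
    = i , j<i , m≤n⇒m≤1+n i≤n , trans (cong isαγ (get-old T r (suc j) i≤n)) q

Valid-pred : ∀ {T : Stair n} {r} → Valid (T ▷ r) → Valid T
Valid-pred {n} {T} {r} v = record
  { diag = λ j<n → trans (cong isLab (sym (get-old T r _ j<n))) (diag (m≤n⇒m≤1+n j<n))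
  ; col  = λ j<i i<i' i'≤n lab → trans (cong isLab (sym (get-old T r _ i'≤n)))
      (col j<i i<i' (m≤n⇒m≤1+n i'≤n) (trans (cong isαγ (get-old T r _ (<⇒≤ (<-≤-trans i<i' i'≤n)))) lab))
  ; row  = λ i≤n j<i j'<j lab → trans (cong isLab (sym (get-old T r _ i≤n)))
      (row (m≤n⇒m≤1+n i≤n) j<i j'<j (trans (cong isβδ (get-old T r _ i≤n)) lab))
  }
  where open Valid v

-- In a valid filling the cells above an α or γ are empty, so later rows leave it topmost. With the
-- converse `αγ-top⇒αγ-cell`, the column rule can be tested on `tops` alone.
αγ-cell⇒αγ-top : ∀ (T : Stair n) → Valid T → ∀ {i j} → j < i → i ≤ n →
  isαγ (get T i (suc j)) ≡ true → isαγ (nth (toList (tops T)) j) ≡ true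
αγ-cell⇒αγ-top []              v (s≤s _) () h
αγ-cell⇒αγ-top {suc n} (T ▷ r) v {i} {j} j<i i≤ h
  rewrite nth-tops-▷ T r j with m≤n⇒m<n∨m≡n i≤
... | inj₁ (s≤s i≤n) = trans (cong (λ x → isαγ (x <∣> nth (toList (tops T)) j)) (empty _ r-empty))
                             (αγ-cell⇒αγ-top T (Valid-pred v) j<i i≤n (trans (cong isαγ (sym (get-old T r _ i≤n))) h))
  where
  r-empty : isLab (nth (toList r) j) ≡ false
  r-empty = trans (cong isLab (sym (get-top T r (suc j)))) (Valid.col v j<i (s≤s i≤n) ≤-refl h)
  empty : ∀ x → isLab x ≡ false → x ≡ nothing
  empty nothing _ = refl
... | inj₂ refl = top (nth (toList r) j) (trans (cong isαγ (sym (get-top T r (suc j)))) h)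
  where
  top : ∀ x {y} → isαγ x ≡ true → isαγ (x <∣> y) ≡ true
  top (just _) p = p

Valid-▷⇒ : ∀ {T : Stair n} {r} → Valid (T ▷ r) →
  isLab (nth (toList r) n) ≡ true × RowValid r (tops T ∷ʳ nothing)
Valid-▷⇒ {n} {T} {r} v = trans (cong isLab (sym (get-top T r (suc n)))) (diag ≤-refl) , cl , rw
  where
  open Valid v
  cl : ∀ j → isαγ (nth (toList (tops T ∷ʳ nothing)) j) ≡ true → isLab (nth (toList r) j) ≡ false
  cl j p with i , j<i , i≤n , q ← αγ-top⇒αγ-cell T j (trans (cong isαγ (sym (nth-∷ʳ-nothing (tops T) j))) p)
         = trans (cong isLab (sym (get-top T r (suc j))))
                 (col j<i (s≤s i≤n) ≤-refl (trans (cong isαγ (get-old T r _ i≤n)) q))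
  rw : ∀ {j' j} → j' < j → isβδ (nth (toList r) j) ≡ true → isLab (nth (toList r) j') ≡ false
  rw {j'} {j} j'<j p with j ≤? n
  ... | yes j≤n = trans (cong isLab (sym (get-top T r (suc j'))))
                    (row ≤-refl (s≤s j≤n) j'<j (trans (cong isβδ (get-top T r (suc j))) p))
  ... | no  j≰n with () ← trans (sym p) (cong isβδ (nth-≥ r (≰⇒> j≰n)))

Valid-▷⇐ : ∀ {T : Stair n} {r} → Valid T → isLab (nth (toList r) n) ≡ true →
  RowValid r (tops T ∷ʳ nothing) → Valid (T ▷ r)
Valid-▷⇐ {n} {T} {r} v lab (cl , rw) = record { diag = diag′ ; col = col′ ; row = row′ }
  where
  open Valid v
  diag′ : ∀ {j} → j < suc n → isLab (get (T ▷ r) (suc j) (suc j)) ≡ true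
  diag′ {j} (s≤s j≤n) with m≤n⇒m<n∨m≡n j≤n
  ... | inj₁ j<n  = trans (cong isLab (get-old T r _ j<n)) (diag j<n)
  ... | inj₂ refl = trans (cong isLab (get-top T r _)) lab
  col′ : ∀ {i j i'} → j < i → i < i' → i' ≤ suc n →
         isαγ (get (T ▷ r) i (suc j)) ≡ true → isLab (get (T ▷ r) i' (suc j)) ≡ false
  col′ {i} {j} j<i i<i' i'≤ p with m≤n⇒m<n∨m≡n i'≤
  ... | inj₁ (s≤s i'≤n) = trans (cong isLab (get-old T r _ i'≤n))
          (col j<i i<i' i'≤n (trans (cong isαγ (sym (get-old T r _ (<⇒≤ (<-≤-trans i<i' i'≤n))))) p))
  ... | inj₂ refl = trans (cong isLab (get-top T r _))
          (cl j (trans (cong isαγ (nth-∷ʳ-nothing (tops T) j))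
            (αγ-cell⇒αγ-top T v j<i (s≤s⁻¹ i<i') (trans (cong isαγ (sym (get-old T r _ (s≤s⁻¹ i<i')))) p))))
  row′ : ∀ {i j j'} → i ≤ suc n → j < i → j' < j →
         isβδ (get (T ▷ r) i (suc j)) ≡ true → isLab (get (T ▷ r) i (suc j')) ≡ false
  row′ i≤ j<i j'<j p with m≤n⇒m<n∨m≡n i≤
  ... | inj₁ (s≤s i≤n) = trans (cong isLab (get-old T r _ i≤n))
                           (row i≤n j<i j'<j (trans (cong isβδ (sym (get-old T r _ i≤n))) p))
  ... | inj₂ refl = trans (cong isLab (get-top T r _))
                      (rw j'<j (trans (cong isβδ (sym (get-top T r _))) p))

-- Going through `Valid`, where the rules split by rows, gives an equality of Booleans. Its right
-- side is a conjunction, so the indicator of a staircase tableau factors into one for `T` and one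
-- for the new row. The appended `nothing` is the state of the column that the new row opens.
isStaircase-▷ : ∀ (T : Stair n) r → isStaircase (T ▷ r) ≡
  isStaircase T ∧ (isLab (nth (toList r) n) ∧ rowFits nothing r (tops T ∷ʳ nothing))
isStaircase-▷ {n} T r = ⇔→≡ (mk⇔ to from)
  where
  ss = tops T ∷ʳ nothing
  to : isStaircase (T ▷ r) ≡ true → isStaircase T ∧ (isLab (nth (toList r) n) ∧ rowFits nothing r ss) ≡ true
  to h with v ← isStaircase⇒Valid (T ▷ r) h with lab , rv ← Valid-▷⇒ v =
    cong₂ _∧_ (Valid⇒isStaircase T (Valid-pred v)) (cong₂ _∧_ lab (RowValid⇒rowFits r ss rv))
  from : isStaircase T ∧ (isLab (nth (toList r) n) ∧ rowFits nothing r ss) ≡ true → isStaircase (T ▷ r) ≡ true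
  from h = Valid⇒isStaircase (T ▷ r) (Valid-▷⇐ (isStaircase⇒Valid T (∧-conicalˡ _ _ h))
    (∧-conicalˡ _ _ (∧-conicalʳ (isStaircase T) _ h))
    (rowFits⇒RowValid r ss (∧-conicalʳ (isLab (nth (toList r) n)) _ (∧-conicalʳ (isStaircase T) _ h))))

-- The q-rule for empty cells when a row is added.

qCell : Cell → Cell → Bool
qCell ρ s = if isδ ρ then true else (if isαγ ρ then isβγ s else false)

applyUpTo-cong : ∀ {ℓ} {C : Set ℓ} {f g : ℕ → C} → (∀ i → f i ≡ g i) → ∀ n → applyUpTo f n ≡ applyUpTo g n
applyUpTo-cong h zero    = refl
applyUpTo-cong h (suc n) = cong₂ _∷_ (h 0) (applyUpTo-cong (h ∘ suc) n)

applyUpTo-nth : ∀ j (xs : List Cell) → applyUpTo (λ k → nth xs (j + k)) (length xs ∸ j) ≡ drop j xs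
applyUpTo-nth zero    []       = refl
applyUpTo-nth zero    (x ∷ xs) = cong (x ∷_) (applyUpTo-nth zero xs)
applyUpTo-nth (suc j) []       = refl
applyUpTo-nth (suc j) (x ∷ xs) = applyUpTo-nth j xs

rightOf-top : ∀ (T : Stair n) r j → rightOf (T ▷ r) (suc n) (suc j) ≡ nearest (drop (suc j) (toList r))
rightOf-top {n} T r j = cong nearest (begin
  map (λ j' → get (T ▷ r) (suc n) j') (map (suc (suc j) +_) (upTo (n ∸ j)))
    ≡⟨ map-∘ (upTo (n ∸ j)) ⟨
  map (λ k → get (T ▷ r) (suc n) (suc (suc j) + k)) (upTo (n ∸ j))
    ≡⟨ map-cong (λ k → get-top T r (suc (suc j) + k)) (upTo (n ∸ j)) ⟩
  map (λ k → nth (toList r) (suc j + k)) (upTo (n ∸ j))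
    ≡⟨ map-upTo _ (n ∸ j) ⟩
  applyUpTo (λ k → nth (toList r) (suc j + k)) (n ∸ j)
    ≡⟨ cong (λ l → applyUpTo (λ k → nth (toList r) (suc j + k)) (l ∸ suc j)) (length-toList r) ⟨
  applyUpTo (λ k → nth (toList r) (suc j + k)) (length (toList r) ∸ suc j)
    ≡⟨ applyUpTo-nth (suc j) (toList r) ⟩
  drop (suc j) (toList r) ∎)
  where open ≡-Reasoning

belowOf-top : ∀ (T : Stair n) r j → belowOf (T ▷ r) (suc n) (suc j) ≡ nth (toList (tops T)) j
belowOf-top {n} T r j = trans
  (cong nearest (map-cong-∈ _ λ i∈ → get-old T r (suc j) (proj₂ (∈-range⁻ {suc j} (reverse⁻ i∈)))))
  (nearest-column T j)

-- The q-rule in the new row sees the tableau below only through `tops`. Together with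
-- `isStaircase-▷` this lets the column states stand in for the whole tableau.
receivesQ-top : ∀ (T : Stair n) r j →
  receivesQ (T ▷ r) (suc n) (suc j) ≡ qCell (nearest (drop (suc j) (toList r))) (nth (toList (tops T)) j)
receivesQ-top T r j = cong₂ qCell (rightOf-top T r j) (belowOf-top T r j)

-- One search runs along row `i`, the other through the rows below it, so a row added on top is
-- never reached.
receivesQ-old : ∀ (T : Stair n) r {i} j → i ≤ n → receivesQ (T ▷ r) i j ≡ receivesQ T i j
receivesQ-old {n} T r {i} j i≤n = cong₂ qCell
  (cong nearest (map-cong-∈ (range (suc j) i) λ {j'} _ → get-old T r j' i≤n))
  (cong nearest (map-cong-∈ _ λ i'∈ →
    get-old T r j (≤-trans (proj₂ (∈-range⁻ {j} (reverse⁻ i'∈))) (≤-trans (∸-monoˡ-≤ 1 i≤n) (m∸n≤m n 1)))))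

-- Splitting off the rightmost cell of a row.

nearest-∷ʳ : ∀ (r : Vec Cell n) x ρ →
  nearest (toList (r ∷ʳ x)) <∣> ρ ≡ nearest (toList r) <∣> (x <∣> ρ)
nearest-∷ʳ []            nothing  ρ = refl
nearest-∷ʳ []            (just _) ρ = refl
nearest-∷ʳ (nothing ∷ r) x        ρ = nearest-∷ʳ r x ρ
nearest-∷ʳ (just _ ∷ r)  x        ρ = refl

-- `rowFits` recurses from the left, whereas the transfer reads from the right. Once the last cell
-- is removed, the nearest label to the right of the rest is `x` if `x` is a label, and `ρ`
-- otherwise.
rowFits-∷ʳ : ∀ ρ (r ss : Vec Cell n) x s →
  rowFits ρ (r ∷ʳ x) (ss ∷ʳ s) ≡ fits x s ρ ∧ rowFits (x <∣> ρ) r ss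
rowFits-∷ʳ ρ []      []        x s = refl
rowFits-∷ʳ ρ (y ∷ r) (s′ ∷ ss) x s = begin
  fits y s′ (nearest (toList (r ∷ʳ x)) <∣> ρ) ∧ rowFits ρ (r ∷ʳ x) (ss ∷ʳ s)
    ≡⟨ cong₂ (λ ρ′ → fits y s′ ρ′ ∧_) (nearest-∷ʳ r x ρ) (rowFits-∷ʳ ρ r ss x s) ⟩
  fits y s′ (nearest (toList r) <∣> (x <∣> ρ)) ∧ (fits x s ρ ∧ rowFits (x <∣> ρ) r ss)
    ≡⟨ ∧-swap (fits y s′ (nearest (toList r) <∣> (x <∣> ρ))) (fits x s ρ) ⟩
  fits x s ρ ∧ (fits y s′ (nearest (toList r) <∣> (x <∣> ρ)) ∧ rowFits (x <∣> ρ) r ss) ∎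
  where
  open ≡-Reasoning
  ∧-swap : ∀ a b {c} → a ∧ (b ∧ c) ≡ b ∧ (a ∧ c)
  ∧-swap true  b     = refl
  ∧-swap false true  = refl
  ∧-swap false false = refl

module Transfer {c ℓ} (R : CommutativeRing c ℓ) (α β γ δ q : CommutativeRing.Carrier R) where
  open CommutativeRing R
    using (Carrier; _≈_; _*_; 0#; 1#; setoid; reflexive; commutativeSemiring; +-cong; +-congˡ; +-congʳ; +-identityˡ; +-identityʳ;
           +-assoc; *-cong; *-congˡ; *-congʳ; *-assoc; *-identityˡ; *-identityʳ; zeroˡ; zeroʳ; distribˡ)
    renaming (_+_ to _⊕_; refl to ≈-refl; sym to ≈-sym; trans to ≈-trans)
  open Weights R α β γ δ q
  open Solver commutativeSemiring using (solve; _:=_; _:+_; _:*_; con)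
  open ≈-Reasoning setoid

  -- Finite sums and products in the ring.

  ∑ : List A → (A → Carrier) → Carrier
  ∑ xs F = sumL (map F xs)

  ∑-cong : ∀ (xs : List A) {F G} → (∀ x → F x ≈ G x) → ∑ xs F ≈ ∑ xs G
  ∑-cong []       h = ≈-refl
  ∑-cong (x ∷ xs) h = +-cong (h x) (∑-cong xs h)

  ∑-map : ∀ (f : A → B) xs F → ∑ (map f xs) F ≈ ∑ xs (F ∘ f)
  ∑-map f []       F = ≈-refl
  ∑-map f (x ∷ xs) F = +-congˡ (∑-map f xs F)

  ∑-++ : ∀ (xs ys : List A) F → ∑ (xs ++ ys) F ≈ ∑ xs F ⊕ ∑ ys F
  ∑-++ []       ys F = ≈-sym (+-identityˡ _)
  ∑-++ (x ∷ xs) ys F = ≈-trans (+-congˡ (∑-++ xs ys F)) (≈-sym (+-assoc _ _ _))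

  ∑-concatMap : ∀ (f : A → List B) xs F → ∑ (concatMap f xs) F ≈ ∑ xs (λ x → ∑ (f x) F)
  ∑-concatMap f []       F = ≈-refl
  ∑-concatMap f (x ∷ xs) F = ≈-trans (∑-++ (f x) _ F) (+-congˡ (∑-concatMap f xs F))

  ∑-*ˡ : ∀ (xs : List A) k F → ∑ xs (λ x → k * F x) ≈ k * ∑ xs F
  ∑-*ˡ []       k F = ≈-sym (zeroʳ k)
  ∑-*ˡ (x ∷ xs) k F = ≈-trans (+-congˡ (∑-*ˡ xs k F)) (≈-sym (distribˡ k _ _))

  ∑-zero : ∀ (xs : List A) → ∑ xs (λ _ → 0#) ≈ 0#
  ∑-zero []       = ≈-refl
  ∑-zero (x ∷ xs) = ≈-trans (+-identityˡ _) (∑-zero xs)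

  ∑-+ : ∀ (xs : List A) F G → ∑ xs (λ x → F x ⊕ G x) ≈ ∑ xs F ⊕ ∑ xs G
  ∑-+ []       F G = ≈-sym (+-identityˡ 0#)
  ∑-+ (x ∷ xs) F G = ≈-trans (+-congˡ (∑-+ xs F G))
    (solve 4 (λ a b c d → (a :+ b) :+ (c :+ d) := (a :+ c) :+ (b :+ d)) ≈-refl _ _ _ _)

  ∑-swap : ∀ (xs : List A) (ys : List B) (F : A → B → Carrier) → ∑ xs (λ x → ∑ ys (F x)) ≈ ∑ ys (λ y → ∑ xs (λ x → F x y))
  ∑-swap []       ys F = ≈-sym (∑-zero ys)
  ∑-swap (x ∷ xs) ys F = ≈-trans (+-congˡ (∑-swap xs ys F)) (≈-sym (∑-+ ys (F x) (λ y → ∑ xs (λ x → F x y))))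

  prodL-++ : ∀ xs ys → prodL (xs ++ ys) ≈ prodL xs * prodL ys
  prodL-++ []       ys = ≈-sym (*-identityˡ _)
  prodL-++ (x ∷ xs) ys = ≈-trans (*-congˡ (prodL-++ xs ys)) (≈-sym (*-assoc _ _ _))

  -- Factorization of the weight along the top row.

  gate : Bool → Carrier → Carrier
  gate b x = if b then x else 0#

  gate-∧ : ∀ a b {x y} → gate (a ∧ b) (x * y) ≈ gate a x * gate b y
  gate-∧ true  true  = ≈-refl
  gate-∧ true  false = ≈-sym (zeroʳ _)
  gate-∧ false b     = ≈-sym (zeroˡ _)

  gate-cong : ∀ b {x y} → x ≈ y → gate b x ≈ gate b y
  gate-cong true  h = h
  gate-cong false h = ≈-refl

  cellVal : Cell → Bool → Carrier
  cellVal (just l) _ = labelVal l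
  cellVal nothing  b = if b then q else 1#

  cellWeight≡ : ∀ (T : Stair n) i j → cellWeight T (i , j) ≡ cellVal (get T i j) (receivesQ T i j)
  cellWeight≡ T i j with get T i j
  ... | just _  = refl
  ... | nothing = refl

  rowWeight : Cell → Vec Cell n → Vec Cell n → Carrier
  rowWeight ρ []      []       = 1#
  rowWeight ρ (x ∷ r) (s ∷ ss) = cellVal x (qCell (nearest (toList r) <∣> ρ) s) * rowWeight ρ r ss

  rowWeight-indexed : ∀ (r ss : Vec Cell n) →
    prodL (applyUpTo (λ j → cellVal (nth (toList r) j)
                              (qCell (nearest (drop (suc j) (toList r))) (nth (toList ss) j))) n)
    ≡ rowWeight nothing r ss
  rowWeight-indexed []      []       = refl
  rowWeight-indexed (x ∷ r) (s ∷ ss) =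
    cong₂ (λ ρ → cellVal x (qCell ρ s) *_) (sym (<∣>-identityʳ (nearest (toList r)))) (rowWeight-indexed r ss)

  -- Old cells keep their weights when a row is added above them, and the weights in the new row
  -- depend on `T` only through `tops T`.
  wT-▷ : ∀ (T : Stair n) r → wT (T ▷ r) ≈ wT T * rowWeight nothing r (tops T ∷ʳ nothing)
  wT-▷ {n} T r = begin
    prodL (map (cellWeight (T ▷ r)) (cells (suc n)))
      ≡⟨ cong (prodL ∘ map (cellWeight (T ▷ r))) (cells-suc n) ⟩
    prodL (map (cellWeight (T ▷ r)) (cells n ++ map (suc n ,_) (range 1 (suc n))))
      ≡⟨ cong prodL (map-++ (cellWeight (T ▷ r)) (cells n) _) ⟩
    prodL (map (cellWeight (T ▷ r)) (cells n) ++ map (cellWeight (T ▷ r)) (map (suc n ,_) (range 1 (suc n))))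
      ≡⟨ cong₂ (λ xs ys → prodL (xs ++ ys)) (map-cong-∈ (cells n) (λ {c} c∈ → old c (proj₂ (proj₂ (∈-cells⁻ c∈))))) top ⟩
    prodL (map (cellWeight T) (cells n) ++ applyUpTo topCell (suc n))
      ≈⟨ prodL-++ (map (cellWeight T) (cells n)) _ ⟩
    wT T * prodL (applyUpTo topCell (suc n))
      ≡⟨ cong (wT T *_) (rowWeight-indexed r (tops T ∷ʳ nothing)) ⟩
    wT T * rowWeight nothing r (tops T ∷ʳ nothing) ∎
    where
    topCell : ℕ → Carrier
    topCell j = cellVal (nth (toList r) j)
      (qCell (nearest (drop (suc j) (toList r))) (nth (toList (tops T ∷ʳ nothing)) j))
    old : ∀ c → proj₁ c ≤ n → cellWeight (T ▷ r) c ≡ cellWeight T c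
    old (i , j) i≤n = trans (cellWeight≡ (T ▷ r) i j)
      (trans (cong₂ cellVal (get-old T r j i≤n) (receivesQ-old T r j i≤n)) (sym (cellWeight≡ T i j)))
    top-cell : ∀ j → cellWeight (T ▷ r) (suc n , suc j) ≡ topCell j
    top-cell j = trans (cellWeight≡ (T ▷ r) (suc n) (suc j)) (cong₂ cellVal (get-top T r (suc j))
      (trans (receivesQ-top T r j)
             (cong (qCell (nearest (drop (suc j) (toList r)))) (sym (nth-∷ʳ-nothing (tops T) j)))))
    top : map (cellWeight (T ▷ r)) (map (suc n ,_) (range 1 (suc n))) ≡ applyUpTo topCell (suc n)
    top = trans (sym (map-∘ (range 1 (suc n)))) (trans (sym (map-∘ (upTo (suc n))))
            (trans (map-upTo _ (suc n)) (applyUpTo-cong top-cell (suc n))))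

  rowWeight-∷ʳ : ∀ ρ (r ss : Vec Cell n) x s →
    rowWeight ρ (r ∷ʳ x) (ss ∷ʳ s) ≈ cellVal x (qCell ρ s) * rowWeight (x <∣> ρ) r ss
  rowWeight-∷ʳ ρ []      []        x s = ≈-refl
  rowWeight-∷ʳ ρ (y ∷ r) (s′ ∷ ss) x s = begin
    cellVal y (qCell (nearest (toList (r ∷ʳ x)) <∣> ρ) s′) * rowWeight ρ (r ∷ʳ x) (ss ∷ʳ s)
      ≈⟨ *-cong (reflexive (cong (λ ρ′ → cellVal y (qCell ρ′ s′)) (nearest-∷ʳ r x ρ))) (rowWeight-∷ʳ ρ r ss x s) ⟩
    cellVal y (qCell (nearest (toList r) <∣> (x <∣> ρ)) s′) * (cellVal x (qCell ρ s) * rowWeight (x <∣> ρ) r ss)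
      ≈⟨ solve 3 (λ a b c → a :* (b :* c) := b :* (a :* c)) ≈-refl _ _ _ ⟩
    cellVal x (qCell ρ s) * (cellVal y (qCell (nearest (toList r) <∣> (x <∣> ρ)) s′) * rowWeight (x <∣> ρ) r ss) ∎

  cellTerm : Cell → Cell → Cell → Carrier
  cellTerm x s ρ = gate (fits x s ρ) (cellVal x (qCell ρ s))

  rowTerm : Cell → Vec Cell n → Vec Cell n → Carrier
  rowTerm ρ r ss = gate (rowFits ρ r ss) (rowWeight ρ r ss)

  rowTerm-∷ʳ : ∀ ρ (r ss : Vec Cell n) x s →
    rowTerm ρ (r ∷ʳ x) (ss ∷ʳ s) ≈ cellTerm x s ρ * rowTerm (x <∣> ρ) r ss
  rowTerm-∷ʳ ρ r ss x s = begin
    gate (rowFits ρ (r ∷ʳ x) (ss ∷ʳ s)) (rowWeight ρ (r ∷ʳ x) (ss ∷ʳ s))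
      ≈⟨ gate-cong (rowFits ρ (r ∷ʳ x) (ss ∷ʳ s)) (rowWeight-∷ʳ ρ r ss x s) ⟩
    gate (rowFits ρ (r ∷ʳ x) (ss ∷ʳ s)) (cellVal x (qCell ρ s) * rowWeight (x <∣> ρ) r ss)
      ≡⟨ cong (λ b → gate b (cellVal x (qCell ρ s) * rowWeight (x <∣> ρ) r ss)) (rowFits-∷ʳ ρ r ss x s) ⟩
    gate (fits x s ρ ∧ rowFits (x <∣> ρ) r ss) (cellVal x (qCell ρ s) * rowWeight (x <∣> ρ) r ss)
      ≈⟨ gate-∧ (fits x s ρ) (rowFits (x <∣> ρ) r ss) ⟩
    cellTerm x s ρ * rowTerm (x <∣> ρ) r ss ∎

  diagTerm : Cell → Carrier
  diagTerm nothing  = 0#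
  diagTerm (just l) = labelVal l

  stairTerm : Stair n → Carrier
  stairTerm T = gate (isStaircase T) (wT T)

  -- Indicator and weight split in the same way: the old tableau, the diagonal cell, and the other
  -- cells of the row, for which the diagonal label is the first one on the right.
  stairTerm-▷ : ∀ (T : Stair n) r x →
    stairTerm (T ▷ (r ∷ʳ x)) ≈ stairTerm T * (diagTerm x * rowTerm x r (tops T))
  stairTerm-▷ {n} T r x = begin
    gate (isStaircase (T ▷ (r ∷ʳ x))) (wT (T ▷ (r ∷ʳ x)))
      ≈⟨ gate-cong (isStaircase (T ▷ (r ∷ʳ x))) (wT-▷ T (r ∷ʳ x)) ⟩
    gate (isStaircase (T ▷ (r ∷ʳ x))) (wT T * rowWeight nothing (r ∷ʳ x) ss)
      ≡⟨ cong (λ b → gate b (wT T * rowWeight nothing (r ∷ʳ x) ss)) (isStaircase-▷ T (r ∷ʳ x)) ⟩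
    gate (isStaircase T ∧ (isLab (nth (toList (r ∷ʳ x)) n) ∧ rowFits nothing (r ∷ʳ x) ss)) (wT T * rowWeight nothing (r ∷ʳ x) ss)
      ≈⟨ gate-∧ (isStaircase T) _ ⟩
    stairTerm T * gate (isLab (nth (toList (r ∷ʳ x)) n) ∧ rowFits nothing (r ∷ʳ x) ss) (rowWeight nothing (r ∷ʳ x) ss)
      ≡⟨ cong (λ y → stairTerm T * gate (isLab y ∧ rowFits nothing (r ∷ʳ x) ss) (rowWeight nothing (r ∷ʳ x) ss)) (nth-∷ʳ-last r x) ⟩
    stairTerm T * gate (isLab x ∧ rowFits nothing (r ∷ʳ x) ss) (rowWeight nothing (r ∷ʳ x) ss)
      ≈⟨ *-congˡ (last-cell x) ⟩
    stairTerm T * (diagTerm x * rowTerm x r (tops T)) ∎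
    where
    ss = tops T ∷ʳ nothing
    last-cell : ∀ x → gate (isLab x ∧ rowFits nothing (r ∷ʳ x) ss) (rowWeight nothing (r ∷ʳ x) ss)
                      ≈ diagTerm x * rowTerm x r (tops T)
    last-cell nothing  = ≈-sym (zeroˡ _)
    -- The diagonal cell has nothing below it or to its right, so a label there always fits and its
    -- `cellTerm` computes to `labelVal l`.
    last-cell (just l) = rowTerm-∷ʳ nothing r (tops T) (just l) nothing

  -- Sums over rows and the operators they define on functionals.

  ∑-allVec : ∀ n F → ∑ (allVec (suc n)) F ≈ ∑ allLabels (λ x → ∑ (allVec n) (λ r → F (x ∷ r)))
  ∑-allVec n F = ≈-trans (∑-concatMap (λ x → map (x ∷_) (allVec n)) allLabels F) (∑-cong allLabels λ x → ∑-map (x ∷_) (allVec n) F)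

  -- `allVec` enumerates by the leftmost cell; induction and an exchange of two sums make the
  -- rightmost cell the outer index.
  ∑-allVec-∷ʳ : ∀ n F → ∑ (allVec (suc n)) F ≈ ∑ allLabels (λ x → ∑ (allVec n) (λ r → F (r ∷ʳ x)))
  ∑-allVec-∷ʳ zero    F = ∑-allVec zero F
  ∑-allVec-∷ʳ (suc n) F = begin
    ∑ (allVec (suc (suc n))) F
      ≈⟨ ∑-allVec (suc n) F ⟩
    ∑ allLabels (λ y → ∑ (allVec (suc n)) (λ r → F (y ∷ r)))
      ≈⟨ ∑-cong allLabels (λ y → ∑-allVec-∷ʳ n (F ∘ (y ∷_))) ⟩
    ∑ allLabels (λ y → ∑ allLabels (λ x → ∑ (allVec n) (λ r → F (y ∷ (r ∷ʳ x)))))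
      ≈⟨ ∑-swap allLabels allLabels (λ y x → ∑ (allVec n) (λ r → F (y ∷ (r ∷ʳ x)))) ⟩
    ∑ allLabels (λ x → ∑ allLabels (λ y → ∑ (allVec n) (λ r → F (y ∷ (r ∷ʳ x)))))
      ≈⟨ ∑-cong allLabels (λ x → ∑-allVec n (λ r → F (r ∷ʳ x))) ⟨
    ∑ allLabels (λ x → ∑ (allVec (suc n)) (λ r → F (r ∷ʳ x))) ∎

  -- Elements of V^⊗n are represented by their pairings with functions of the column states.
  Functional : ℕ → Set c
  Functional n = Vec Cell n → Carrier

  infixl 7 _▸_
  -- Contraction with a basis vector. The head of a word belongs to the last column, so the leading
  -- tensor factor of Φ is the last entry of the state vector.
  _▸_ : Functional (suc n) → Cell → Functional n
  (f ▸ x) ss = f (ss ∷ʳ x)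

  ▸-cong : ∀ {f g : Functional (suc n)} → (∀ ss → f ss ≈ g ss) → ∀ x ss → (f ▸ x) ss ≈ (g ▸ x) ss
  ▸-cong h x ss = h (ss ∷ʳ x)

  -- The transfer operator of a partial row in transposed form: `f` is pulled back from the states
  -- after the row is added to the states before. `ρ` is the label that bounds the row on the right,
  -- and labels in `r` override old states.
  rowSum : Cell → Functional n → Functional n
  rowSum {n} ρ f ss = ∑ (allVec n) (λ r → rowTerm ρ r ss * f (zipWith _<∣>_ r ss))

  rowSum-cong : ∀ ρ {f g : Functional n} → (∀ ss → f ss ≈ g ss) → ∀ ss → rowSum ρ f ss ≈ rowSum ρ g ss
  rowSum-cong {n} ρ h ss = ∑-cong (allVec n) λ r → *-congˡ (h (zipWith _<∣>_ r ss))

  rowSum-∷ʳ : ∀ ρ (f : Functional (suc n)) ss s →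
    rowSum ρ f (ss ∷ʳ s) ≈ ∑ allLabels (λ x → cellTerm x s ρ * rowSum (x <∣> ρ) (f ▸ (x <∣> s)) ss)
  rowSum-∷ʳ {n} ρ f ss s = ≈-trans (∑-allVec-∷ʳ n _) (∑-cong allLabels λ x →
    ≈-trans (∑-cong (allVec n) (λ r → begin
      rowTerm ρ (r ∷ʳ x) (ss ∷ʳ s) * f (zipWith _<∣>_ (r ∷ʳ x) (ss ∷ʳ s))
        ≈⟨ *-cong (rowTerm-∷ʳ ρ r ss x s) (reflexive (cong f (zipWith-∷ʳ _<∣>_ r ss x s))) ⟩
      (cellTerm x s ρ * rowTerm (x <∣> ρ) r ss) * (f ▸ (x <∣> s)) (zipWith _<∣>_ r ss)
        ≈⟨ *-assoc _ _ _ ⟩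
      cellTerm x s ρ * (rowTerm (x <∣> ρ) r ss * (f ▸ (x <∣> s)) (zipWith _<∣>_ r ss)) ∎))
    (∑-*ˡ (allVec n) (cellTerm x s ρ) _))

  -- Once a β or δ has been read, the rest of the row is forced to be empty.
  rowSum-blocked : ∀ ρ e → (∀ l s → cellTerm (just l) s ρ ≈ 0#) → (∀ s → cellTerm nothing s ρ ≈ e) →
    ∀ {n} (f : Functional n) ss → rowSum ρ f ss ≈ pow e n * f ss
  rowSum-blocked ρ e h₀ h₁ {zero}  f [] = +-identityʳ _
  rowSum-blocked ρ e h₀ h₁ {suc n} f ss with ss′ , s , refl ← initLast ss = begin
    rowSum ρ f (ss′ ∷ʳ s)
      ≈⟨ rowSum-∷ʳ ρ f ss′ s ⟩
    cellTerm nothing s ρ * rowSum ρ (f ▸ s) ss′ ⊕ ∑ labels (λ l → cellTerm (just l) s ρ * rest l)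
      ≈⟨ +-cong (*-cong (h₁ s) (rowSum-blocked ρ e h₀ h₁ (f ▸ s) ss′))
                (∑-cong labels (λ l → ≈-trans (*-congʳ (h₀ l s)) (zeroˡ (rest l)))) ⟩
    e * (pow e n * f (ss′ ∷ʳ s)) ⊕ ∑ labels (λ _ → 0#)
      ≈⟨ ≈-trans (+-congˡ (∑-zero labels)) (+-identityʳ _) ⟩
    e * (pow e n * f (ss′ ∷ʳ s))
      ≈⟨ *-assoc _ _ _ ⟨
    e * pow e n * f (ss′ ∷ʳ s) ∎
    where
    labels : List Label
    labels = Lα ∷ Lβ ∷ Lγ ∷ Lδ ∷ []
    rest : Label → Carrier
    rest l = rowSum (just l) (f ▸ just l) ss′

  rowSum-δ : ∀ (f : Functional n) ss → rowSum (just Lδ) f ss ≈ pow q n * f ss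
  rowSum-δ = rowSum-blocked (just Lδ) q
    (λ l s → reflexive (cong (λ b → gate b (labelVal l)) (∧-zeroʳ (not (isαγ s))))) (λ s → ≈-refl)

  rowSum-β : ∀ (f : Functional n) ss → rowSum (just Lβ) f ss ≈ f ss
  rowSum-β {n} f ss = ≈-trans (rowSum-blocked (just Lβ) 1#
      (λ l s → reflexive (cong (λ b → gate b (labelVal l)) (∧-zeroʳ (not (isαγ s))))) (λ s → ≈-refl) f ss)
    (≈-trans (*-congʳ (pow-1 n)) (*-identityˡ _))
    where
    pow-1 : ∀ n → pow 1# n ≈ 1#
    pow-1 zero    = ≈-refl
    pow-1 (suc n) = ≈-trans (*-identityˡ _) (pow-1 n)

  -- `fits` asks only whether the label on the right is β or δ, and `qCell` treats α and γ alike
  -- there. Hence one operator R serves both diagonals.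
  rowTerm-γ : ∀ (r ss : Vec Cell n) → rowTerm (just Lγ) r ss ≡ rowTerm (just Lα) r ss
  rowTerm-γ r ss = cong₂ gate (rowFits-γ r ss) (rowWeight-γ r ss)
    where
    fits-γ : ∀ x s ρ → fits x s (ρ <∣> just Lγ) ≡ fits x s (ρ <∣> just Lα)
    fits-γ nothing  s ρ        = refl
    fits-γ (just _) s nothing  = refl
    fits-γ (just _) s (just _) = refl
    qCell-γ : ∀ ρ s → qCell (ρ <∣> just Lγ) s ≡ qCell (ρ <∣> just Lα) s
    qCell-γ nothing  s = refl
    qCell-γ (just _) s = refl
    rowFits-γ : ∀ {n} (r ss : Vec Cell n) → rowFits (just Lγ) r ss ≡ rowFits (just Lα) r ss
    rowFits-γ []      []       = refl
    rowFits-γ (x ∷ r) (s ∷ ss) = cong₂ _∧_ (fits-γ x s (nearest (toList r))) (rowFits-γ r ss)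
    rowWeight-γ : ∀ {n} (r ss : Vec Cell n) → rowWeight (just Lγ) r ss ≡ rowWeight (just Lα) r ss
    rowWeight-γ []      []       = refl
    rowWeight-γ (x ∷ r) (s ∷ ss) =
      cong₂ (λ b → cellVal x b *_) (qCell-γ (nearest (toList r)) s) (rowWeight-γ r ss)

  -- The operator R, column by column.

  openRow : Functional n → Functional n
  openRow = rowSum (just Lα)

  rowSum-γ : ∀ (f : Functional n) ss → rowSum (just Lγ) f ss ≈ openRow f ss
  rowSum-γ f ss = ∑-cong (allVec _) λ r → *-congʳ (reflexive (rowTerm-γ r ss))

  drop-zeros : ∀ a b c d e → a ⊕ (0# * b ⊕ (0# * c ⊕ (0# * d ⊕ (0# * e ⊕ 0#)))) ≈ a
  drop-zeros = solve 5 (λ a b c d e →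
    a :+ (con 0 :* b :+ (con 0 :* c :+ (con 0 :* d :+ (con 0 :* e :+ con 0)))) := a) ≈-refl

  -- A column topped by α or γ is closed, so only the empty entry survives; in an open row it weighs
  -- 1 above α and `q` above γ. The states to be treated are the four labels, since every column of
  -- a staircase tableau has a label on its diagonal.
  openRow-α : ∀ (f : Functional (suc n)) ss → openRow f (ss ∷ʳ just Lα) ≈ openRow (f ▸ just Lα) ss
  openRow-α f ss = ≈-trans (rowSum-∷ʳ (just Lα) f ss (just Lα))
    (≈-trans (drop-zeros _ _ _ _ _) (*-identityˡ _))

  openRow-γ : ∀ (f : Functional (suc n)) ss → openRow f (ss ∷ʳ just Lγ) ≈ q * openRow (f ▸ just Lγ) ss
  openRow-γ f ss = ≈-trans (rowSum-∷ʳ (just Lα) f ss (just Lγ)) (drop-zeros _ _ _ _ _)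

  -- The contribution of a label placed in an open column, the same whether β or δ stood below.
  -- After α or γ the row stays open; after δ or β it must be empty, each cell weighing `q` or 1
  -- respectively.
  insertions : Functional (suc n) → Functional n
  insertions {n} f ss =
      (α * openRow (f ▸ just Lα) ss ⊕ δ * (pow q n * (f ▸ just Lδ) ss))
    ⊕ (γ * openRow (f ▸ just Lγ) ss ⊕ β * (f ▸ just Lβ) ss)

  insertions-correct : ∀ (f : Functional (suc n)) ss t →
    t ⊕ (α * rowSum (just Lα) (f ▸ just Lα) ss ⊕ (β * rowSum (just Lβ) (f ▸ just Lβ) ss
      ⊕ (γ * rowSum (just Lγ) (f ▸ just Lγ) ss ⊕ (δ * rowSum (just Lδ) (f ▸ just Lδ) ss ⊕ 0#))))
    ≈ t ⊕ insertions f ss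
  insertions-correct f ss t = begin
    _ ≈⟨ +-congˡ (+-congˡ (+-cong (*-congˡ (rowSum-β (f ▸ just Lβ) ss))
           (+-cong (*-congˡ (rowSum-γ (f ▸ just Lγ) ss)) (+-congʳ (*-congˡ (rowSum-δ (f ▸ just Lδ) ss)))))) ⟩
    _ ≈⟨ solve 5 (λ t a b c d → t :+ (a :+ (b :+ (c :+ (d :+ con 0)))) := t :+ ((a :+ d) :+ (c :+ b))) ≈-refl t _ _ _ _ ⟩
    t ⊕ insertions f ss ∎

  -- A column topped by δ is open: its cell either stays empty, with weight 1, or receives a label.
  -- Above β the only change is that the empty cell weighs `q`.
  openRow-δ : ∀ (f : Functional (suc n)) ss →
    openRow f (ss ∷ʳ just Lδ) ≈ openRow (f ▸ just Lδ) ss ⊕ insertions f ss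
  openRow-δ f ss = ≈-trans (rowSum-∷ʳ (just Lα) f ss (just Lδ))
    (≈-trans (insertions-correct f ss _) (+-congʳ (*-identityˡ _)))

  openRow-β : ∀ (f : Functional (suc n)) ss →
    openRow f (ss ∷ʳ just Lβ) ≈ q * openRow (f ▸ just Lβ) ss ⊕ insertions f ss
  openRow-β f ss = ≈-trans (rowSum-∷ʳ (just Lα) f ss (just Lβ)) (insertions-correct f ss _)

  -- The transfer vector of a word.

  -- The pairing of the vector Φ(X) with `f`, where R acts through its transpose `openRow`. The
  -- exponent `n` counts the cells to the left of a diagonal δ.
  Φ : Vec Letter n → Functional n → Carrier
  Φ []              f = f []
  Φ {suc n} (● ∷ X) f = α * Φ X (openRow (f ▸ just Lα)) ⊕ δ * (pow q n * Φ X (f ▸ just Lδ))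
  Φ         (○ ∷ X) f = γ * Φ X (openRow (f ▸ just Lγ)) ⊕ β * Φ X (f ▸ just Lβ)

  Φ-cong : ∀ (X : Vec Letter n) {f g : Functional n} → (∀ ss → f ss ≈ g ss) → Φ X f ≈ Φ X g
  Φ-cong []      h = h []
  Φ-cong (● ∷ X) h =
    +-cong (*-congˡ (Φ-cong X (rowSum-cong (just Lα) (▸-cong h (just Lα))))) (*-congˡ (*-congˡ (Φ-cong X (▸-cong h (just Lδ)))))
  Φ-cong (○ ∷ X) h =
    +-cong (*-congˡ (Φ-cong X (rowSum-cong (just Lα) (▸-cong h (just Lγ))))) (*-congˡ (Φ-cong X (▸-cong h (just Lβ))))

  rowSum-+ : ∀ ρ (f g : Functional n) ss → rowSum ρ (λ v → f v ⊕ g v) ss ≈ rowSum ρ f ss ⊕ rowSum ρ g ss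
  rowSum-+ {n} ρ f g ss = ≈-trans
    (∑-cong (allVec n) (λ r → distribˡ (rowTerm ρ r ss) (f (zipWith _<∣>_ r ss)) (g (zipWith _<∣>_ r ss))))
    (∑-+ (allVec n) _ _)

  rowSum-* : ∀ ρ k (f : Functional n) ss → rowSum ρ (λ v → k * f v) ss ≈ k * rowSum ρ f ss
  rowSum-* {n} ρ k f ss = ≈-trans
    (∑-cong (allVec n) (λ r → solve 3 (λ a b c → a :* (b :* c) := b :* (a :* c)) ≈-refl
                                (rowTerm ρ r ss) k (f (zipWith _<∣>_ r ss))))
    (∑-*ˡ (allVec n) k _)

  Φ-+ : ∀ (X : Vec Letter n) (f g : Functional n) → Φ X (λ ss → f ss ⊕ g ss) ≈ Φ X f ⊕ Φ X g
  Φ-+ []      f g = ≈-refl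
  Φ-+ (● ∷ X) f g = ≈-trans
    (+-cong (*-congˡ (≈-trans (Φ-cong X (rowSum-+ (just Lα) (f ▸ just Lα) (g ▸ just Lα))) (Φ-+ X _ _))) (*-congˡ (*-congˡ (Φ-+ X _ _))))
    (solve 7 (λ a d p x y z w → a :* (x :+ y) :+ d :* (p :* (z :+ w))
                := (a :* x :+ d :* (p :* z)) :+ (a :* y :+ d :* (p :* w))) ≈-refl α δ _ _ _ _ _)
  Φ-+ (○ ∷ X) f g = ≈-trans
    (+-cong (*-congˡ (≈-trans (Φ-cong X (rowSum-+ (just Lα) (f ▸ just Lγ) (g ▸ just Lγ))) (Φ-+ X _ _))) (*-congˡ (Φ-+ X _ _)))
    (solve 6 (λ c b x y z w → c :* (x :+ y) :+ b :* (z :+ w)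
                := (c :* x :+ b :* z) :+ (c :* y :+ b :* w)) ≈-refl γ β _ _ _ _)

  Φ-* : ∀ (X : Vec Letter n) k (f : Functional n) → Φ X (λ ss → k * f ss) ≈ k * Φ X f
  Φ-* []      k f = ≈-refl
  Φ-* (● ∷ X) k f = ≈-trans
    (+-cong (*-congˡ (≈-trans (Φ-cong X (rowSum-* (just Lα) k (f ▸ just Lα))) (Φ-* X _ _))) (*-congˡ (*-congˡ (Φ-* X _ _))))
    (solve 6 (λ k a d p x y → a :* (k :* x) :+ d :* (p :* (k :* y)) := k :* (a :* x :+ d :* (p :* y))) ≈-refl k α δ _ _ _)
  Φ-* (○ ∷ X) k f = ≈-trans
    (+-cong (*-congˡ (≈-trans (Φ-cong X (rowSum-* (just Lα) k (f ▸ just Lγ))) (Φ-* X _ _))) (*-congˡ (Φ-* X _ _)))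
    (solve 5 (λ k c b x y → c :* (k :* x) :+ b :* (k :* y) := k :* (c :* x :+ b :* y)) ≈-refl k γ β _ _)

  -- By linearity the four insertions become the four summands in the clauses of `Φ`. This is the
  -- origin of the sums U●V + U○V: inserting a label in an open column amounts to replacing its
  -- letter by ● and by ○.
  Φ-insertions : ∀ (X : Vec Letter n) (f : Functional (suc n)) →
    Φ X (insertions f) ≈ Φ (● ∷ X) f ⊕ Φ (○ ∷ X) f
  Φ-insertions {n} X f = ≈-trans (Φ-+ X _ _) (+-cong
    (≈-trans (Φ-+ X _ _) (+-cong (Φ-* X α _) (≈-trans (Φ-* X δ _) (*-congˡ (Φ-* X (pow q n) _)))))
    (≈-trans (Φ-+ X _ _) (+-cong (Φ-* X γ _) (Φ-* X β _))))

  -- The operator S on words and its intertwining with R.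

  -- The transpose of the operator S on words.
  wordOp : (Vec Letter n → Carrier) → Vec Letter n → Carrier
  wordOp         g []      = g []
  wordOp {suc n} g (● ∷ X) = wordOp (g ∘ (● ∷_)) X ⊕ δ * (pow q n * (g (● ∷ X) ⊕ g (○ ∷ X)))
  wordOp         g (○ ∷ X) = q * wordOp (g ∘ (○ ∷_)) X ⊕ β * (g (● ∷ X) ⊕ g (○ ∷ X))

  wordOp-cong : ∀ {g h : Vec Letter n → Carrier} → (∀ X → g X ≈ h X) → ∀ X → wordOp g X ≈ wordOp h X
  wordOp-cong e []      = e []
  wordOp-cong e (● ∷ X) = +-cong (wordOp-cong (λ Y → e _) X) (*-congˡ (*-congˡ (+-cong (e _) (e _))))
  wordOp-cong e (○ ∷ X) = +-cong (*-congˡ (wordOp-cong (λ Y → e _) X)) (*-congˡ (+-cong (e _) (e _)))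

  wordOp-linear : ∀ (g h : Vec Letter n → Carrier) a b X →
    wordOp (λ Y → a * g Y ⊕ b * h Y) X ≈ a * wordOp g X ⊕ b * wordOp h X
  wordOp-linear g h a b []      = ≈-refl
  wordOp-linear g h a b (● ∷ X) = ≈-trans (+-congʳ (wordOp-linear _ _ a b X))
    (solve 10 (λ a b x y d p g₁ g₂ h₁ h₂ →
      (a :* x :+ b :* y) :+ d :* (p :* ((a :* g₁ :+ b :* h₁) :+ (a :* g₂ :+ b :* h₂)))
      := a :* (x :+ d :* (p :* (g₁ :+ g₂))) :+ b :* (y :+ d :* (p :* (h₁ :+ h₂)))) ≈-refl a b _ _ δ _ _ _ _ _)
  wordOp-linear g h a b (○ ∷ X) = ≈-trans (+-congʳ (*-congˡ (wordOp-linear _ _ a b X)))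
    (solve 10 (λ a b x y d p g₁ g₂ h₁ h₂ →
      p :* (a :* x :+ b :* y) :+ d :* ((a :* g₁ :+ b :* h₁) :+ (a :* g₂ :+ b :* h₂))
      := a :* (p :* x :+ d :* (g₁ :+ g₂)) :+ b :* (p :* y :+ d :* (h₁ :+ h₂))) ≈-refl a b _ _ β q _ _ _ _)

  -- This is Φ(S X) = R Φ(X), by induction on the word. The head letter belongs to the last column,
  -- the first one that an open row meets: leaving its cell empty corresponds to S acting on the
  -- tail, inserting a label to replacing the head while the tail is kept.
  wordOp-Φ : ∀ (f : Functional n) X → wordOp (λ Y → Φ Y f) X ≈ Φ X (openRow f)
  wordOp-Φ f [] = ≈-sym (≈-trans (+-identityʳ _) (*-identityˡ _))
  wordOp-Φ {suc n} f (● ∷ X) = begin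
    wordOp (λ Y → Φ (● ∷ Y) f) X ⊕ δ * (pow q n * (Φ (● ∷ X) f ⊕ Φ (○ ∷ X) f))
      ≈⟨ +-congʳ (wordOp-cong (λ Y → +-congˡ (≈-sym (*-assoc _ _ _))) X) ⟩
    wordOp (λ Y → α * Φ Y (openRow (f ▸ just Lα)) ⊕ δ * pow q n * Φ Y (f ▸ just Lδ)) X ⊕ δ * (pow q n * (Φ (● ∷ X) f ⊕ Φ (○ ∷ X) f))
      ≈⟨ +-congʳ (wordOp-linear _ _ α (δ * pow q n) X) ⟩
    (α * wordOp (λ Y → Φ Y (openRow (f ▸ just Lα))) X ⊕ δ * pow q n * wordOp (λ Y → Φ Y (f ▸ just Lδ)) X)
      ⊕ δ * (pow q n * (Φ (● ∷ X) f ⊕ Φ (○ ∷ X) f))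
      -- The induction hypothesis is taken at `openRow (f ▸ just Lα)` and at `f ▸ just Lδ`, which is
      -- why `f` is arbitrary.
      ≈⟨ +-cong (+-cong (*-congˡ (wordOp-Φ _ X)) (*-congˡ (wordOp-Φ _ X))) (*-congˡ (*-congˡ (≈-sym (Φ-insertions X f)))) ⟩
    (α * Φ X (openRow (openRow (f ▸ just Lα))) ⊕ δ * pow q n * Φ X (openRow (f ▸ just Lδ)))
      ⊕ δ * (pow q n * Φ X (insertions f))
      ≈⟨ solve 6 (λ a d p x y z → (a :* x :+ d :* p :* y) :+ d :* (p :* z) := a :* x :+ d :* (p :* (y :+ z))) ≈-refl α δ _ _ _ _ ⟩
    α * Φ X (openRow (openRow (f ▸ just Lα))) ⊕ δ * (pow q n * (Φ X (openRow (f ▸ just Lδ)) ⊕ Φ X (insertions f)))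
      -- Used backwards, the column lemmas restore `openRow f`; above δ the empty entry and the
      -- insertions recombine.
      ≈⟨ +-cong (*-congˡ (Φ-cong X (rowSum-cong _ (openRow-α f))))
                (*-congˡ (*-congˡ (≈-trans (Φ-cong X (openRow-δ f)) (Φ-+ X _ _)))) ⟨
    α * Φ X (openRow (openRow f ▸ just Lα)) ⊕ δ * (pow q n * Φ X (openRow f ▸ just Lδ)) ∎
  wordOp-Φ {suc n} f (○ ∷ X) = begin
    q * wordOp (λ Y → Φ (○ ∷ Y) f) X ⊕ β * (Φ (● ∷ X) f ⊕ Φ (○ ∷ X) f)
      ≈⟨ +-congʳ (*-congˡ (wordOp-linear _ _ γ β X)) ⟩
    q * (γ * wordOp (λ Y → Φ Y (openRow (f ▸ just Lγ))) X ⊕ β * wordOp (λ Y → Φ Y (f ▸ just Lβ)) X)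
      ⊕ β * (Φ (● ∷ X) f ⊕ Φ (○ ∷ X) f)
      ≈⟨ +-cong (*-congˡ (+-cong (*-congˡ (wordOp-Φ _ X)) (*-congˡ (wordOp-Φ _ X)))) (*-congˡ (≈-sym (Φ-insertions X f))) ⟩
    q * (γ * Φ X (openRow (openRow (f ▸ just Lγ))) ⊕ β * Φ X (openRow (f ▸ just Lβ))) ⊕ β * Φ X (insertions f)
      ≈⟨ solve 6 (λ c b q x y z → q :* (c :* x :+ b :* y) :+ b :* z := c :* (q :* x) :+ b :* (q :* y :+ z)) ≈-refl γ β q _ _ _ ⟩
    γ * (q * Φ X (openRow (openRow (f ▸ just Lγ)))) ⊕ β * (q * Φ X (openRow (f ▸ just Lβ)) ⊕ Φ X (insertions f))
      -- The factor `q` that S attaches to a head ○ is the weight of an empty cell above γ in one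
      -- summand and above β in the other.
      ≈⟨ +-cong
           (*-congˡ (≈-trans (Φ-cong X (λ ss → ≈-trans (rowSum-cong (just Lα) (openRow-γ f) ss) (rowSum-* (just Lα) q (openRow (f ▸ just Lγ)) ss))) (Φ-* X q _)))
           (*-congˡ (≈-trans (Φ-cong X (openRow-β f)) (≈-trans (Φ-+ X _ _) (+-congʳ (Φ-* X q _))))) ⟨
    γ * Φ X (openRow (openRow f ▸ just Lγ)) ⊕ β * Φ X (openRow f ▸ just Lβ) ∎

  -- The recursion of `w` in terms of S.

  flips : (List Letter → Carrier) → List Letter → List Letter → Carrier
  flips g U V = g (U ++ ● ∷ V) ⊕ g (U ++ ○ ∷ V)

  ●-term ○-term : (List Letter → Carrier) → List Letter × List Letter → Carrier
  ●-term g (U , V) = pow q (countCirc U + length V) * flips g U V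
  ○-term g (U , V) = pow q (countCirc U) * flips g U V

  ∑-splits : ∀ a b X F → ∑ (splitsAround a (b ∷ X)) F
    ≈ gate (a ==L b) (F ([] , X)) ⊕ ∑ (splitsAround a X) (λ (U , V) → F (b ∷ U , V))
  ∑-splits ● ● X F = +-congˡ (∑-map _ (splitsAround ● X) F)
  ∑-splits ○ ○ X F = +-congˡ (∑-map _ (splitsAround ○ X) F)
  ∑-splits ● ○ X F = ≈-trans (∑-map _ (splitsAround ● X) F) (≈-sym (+-identityˡ _))
  ∑-splits ○ ● X F = ≈-trans (∑-map _ (splitsAround ○ X) F) (≈-sym (+-identityˡ _))

  -- Prepending ● to U changes neither |○(U)| nor |V|; prepending ○ raises |○(U)| by one, which is
  -- the factor `q` in `wordOp`. The factorization with U empty is the term that replaces the head.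
  wordOp-splits : ∀ (g : List Letter → Carrier) (X : Vec Letter n) → wordOp (g ∘ toList) X ≈
      pow q (countCirc (toList X)) * g (toList X)
    ⊕ (δ * ∑ (splitsAround ● (toList X)) (●-term g) ⊕ β * ∑ (splitsAround ○ (toList X)) (○-term g))
  wordOp-splits g [] = ≈-trans (≈-sym (*-identityˡ _))
    (solve 3 (λ x d b → x := x :+ (d :* con 0 :+ b :* con 0)) ≈-refl _ δ β)
  wordOp-splits {suc n} g (● ∷ X) = begin
    wordOp (g′ ∘ toList) X ⊕ δ * (pow q n * flips g [] Y)
      ≈⟨ +-congʳ (wordOp-splits g′ X) ⟩
    (p * g′ Y ⊕ (δ * S● ⊕ β * S○)) ⊕ δ * (pow q n * flips g [] Y)
      ≈⟨ solve 6 (λ d b x y z w → (x :+ (d :* y :+ b :* z)) :+ d :* w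
                     := x :+ (d :* (w :+ y) :+ b :* (con 0 :+ z))) ≈-refl δ β _ _ _ _ ⟩
    p * g′ Y ⊕ (δ * (pow q n * flips g [] Y ⊕ S●) ⊕ β * (0# ⊕ S○))
      ≡⟨ cong (λ k → p * g′ Y ⊕ (δ * (pow q k * flips g [] Y ⊕ S●) ⊕ β * (0# ⊕ S○))) (length-toList X) ⟨
    p * g′ Y ⊕ (δ * (pow q (length Y) * flips g [] Y ⊕ S●) ⊕ β * (0# ⊕ S○))
      ≈⟨ +-congˡ (+-cong (*-congˡ (∑-splits ● ● Y (●-term g))) (*-congˡ (∑-splits ○ ● Y (○-term g)))) ⟨
    p * g′ Y ⊕ (δ * ∑ (splitsAround ● (● ∷ Y)) (●-term g) ⊕ β * ∑ (splitsAround ○ (● ∷ Y)) (○-term g)) ∎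
    where
    Y  = toList X
    g′ = g ∘ (● ∷_)
    p  = pow q (countCirc Y)
    S● = ∑ (splitsAround ● Y) (●-term g′)
    S○ = ∑ (splitsAround ○ Y) (○-term g′)
  wordOp-splits {suc n} g (○ ∷ X) = begin
    q * wordOp (g′ ∘ toList) X ⊕ β * flips g [] Y
      ≈⟨ +-cong (*-congˡ (wordOp-splits g′ X)) (*-congˡ (≈-sym (*-identityˡ _))) ⟩
    q * (p * g′ Y ⊕ (δ * S● ⊕ β * S○)) ⊕ β * (1# * flips g [] Y)
      ≈⟨ solve 8 (λ q d b p g y z w → q :* (p :* g :+ (d :* y :+ b :* z)) :+ b :* w
                     := q :* p :* g :+ (d :* (con 0 :+ q :* y) :+ b :* (w :+ q :* z))) ≈-refl q δ β _ _ _ _ _ ⟩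
    q * p * g′ Y ⊕ (δ * (0# ⊕ q * S●) ⊕ β * (1# * flips g [] Y ⊕ q * S○))
      ≈⟨ +-congˡ (+-cong
           (*-congˡ (≈-trans (∑-splits ● ○ Y (●-term g)) (+-congˡ (factor-q (splitsAround ● Y) _ _))))
           (*-congˡ (≈-trans (∑-splits ○ ○ Y (○-term g)) (+-congˡ (factor-q (splitsAround ○ Y) _ _))))) ⟨
    q * p * g′ Y ⊕ (δ * ∑ (splitsAround ● (○ ∷ Y)) (●-term g) ⊕ β * ∑ (splitsAround ○ (○ ∷ Y)) (○-term g)) ∎
    where
    Y  = toList X
    g′ = g ∘ (○ ∷_)
    p  = pow q (countCirc Y)
    S● = ∑ (splitsAround ● Y) (●-term g′)
    S○ = ∑ (splitsAround ○ Y) (○-term g′)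
    factor-q : ∀ (xs : List A) (e h : A → Carrier) → ∑ xs (λ x → q * e x * h x) ≈ q * ∑ xs (λ x → e x * h x)
    factor-q xs e h = ≈-trans (∑-cong xs (λ x → *-assoc _ _ _)) (∑-*ˡ xs q _)

  w≈Φ : ∀ (X : Vec Letter n) → wF n (toList X) ≈ Φ X (λ _ → 1#)
  -- S preserves length, so all words occurring in S(X) share the fuel `n` and `w≈Φ` applies to each
  -- of them. The mutual recursion descends because words of length n+1 call this lemma only at
  -- length n.
  wordOp-w : ∀ (X : Vec Letter n) →
      pow q (countCirc (toList X)) * wF n (toList X)
    ⊕ (δ * ∑ (splitsAround ● (toList X)) (●-term (wF n)) ⊕ β * ∑ (splitsAround ○ (toList X)) (○-term (wF n)))
    ≈ Φ X (openRow (λ _ → 1#))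
  wordOp-w {n} X = ≈-trans (≈-sym (wordOp-splits (wF n) X)) (≈-trans (wordOp-cong w≈Φ X) (wordOp-Φ _ X))

  w≈Φ []              = ≈-refl
  w≈Φ {suc n} (● ∷ X) = begin
    -- The three terms of w(●X) containing α add up to α times the value on S(X); the fourth is δ
    -- q^n w(X).
    _ ≈⟨ solve 9 (λ a d b p r w w′ y z → a :* d :* y :+ r :* d :* w :+ p :* a :* w′ :+ a :* b :* z
                    := a :* (p :* w′ :+ (d :* y :+ b :* z)) :+ d :* (r :* w)) ≈-refl
                  α δ β (pow q (countCirc Y)) (pow q (length Y)) (wF n Y) (wF n Y)
                  (∑ (splitsAround ● Y) (●-term (wF n))) (∑ (splitsAround ○ Y) (○-term (wF n))) ⟩
    _ ≈⟨ +-cong (*-congˡ (wordOp-w X)) (*-congˡ (*-cong (reflexive (cong (pow q) (length-toList X))) (w≈Φ X))) ⟩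
    Φ (● ∷ X) (λ _ → 1#) ∎
    where Y = toList X
  w≈Φ {suc n} (○ ∷ X) = begin
    _ ≈⟨ solve 8 (λ c d b p w w′ y z → c :* d :* y :+ p :* c :* w′ :+ c :* b :* z :+ b :* w
                    := c :* (p :* w′ :+ (d :* y :+ b :* z)) :+ b :* w) ≈-refl
                  γ δ β (pow q (countCirc Y)) (wF n Y) (wF n Y)
                  (∑ (splitsAround ● Y) (●-term (wF n))) (∑ (splitsAround ○ Y) (○-term (wF n))) ⟩
    _ ≈⟨ +-cong (*-congˡ (wordOp-w X)) (*-congˡ (w≈Φ X)) ⟩
    Φ (○ ∷ X) (λ _ → 1#) ∎
    where Y = toList X

  -- The sum over tableaux as a pairing with the transfer vector.

  ∑-allStair : ∀ n F → ∑ (allStair (suc n)) F ≈ ∑ (allStair n) (λ T → ∑ allLabels (λ x → ∑ (allVec n) (λ r → F (T ▷ (r ∷ʳ x)))))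
  ∑-allStair n F = ≈-trans (∑-concatMap _ (allStair n) F) (∑-cong (allStair n) λ T →
    ≈-trans (∑-map (T ▷_) (allVec (suc n)) F) (∑-allVec-∷ʳ n (F ∘ (T ▷_))))

  indicator : Bool → Carrier
  indicator b = gate b 1#

  -- A refinement of `tableauSum` by the column states: the freedom in `f` allows the top row to be
  -- absorbed into it during the induction.
  Ψ : ∀ n → List Letter → Functional n → Carrier
  Ψ n m f = ∑ (allStair n) (λ T → indicator (type T ==W m) * (stairTerm T * f (tops T)))

  -- The diagonal entry `x` plays two roles: it bounds the rest of the row on the right and becomes
  -- the state of the new column.
  topRow : Letter → Functional (suc n) → Functional n
  topRow a f ss = ∑ allLabels (λ x → gate (letterOf [] x ==L a) (diagTerm x) * rowSum x (f ▸ x) ss)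

  -- Once the top row is split off, the factors of `T` leave the inner sums, and what remains
  -- depends only on `tops T`.
  Ψ-∷ : ∀ a m (f : Functional (suc n)) → Ψ (suc n) (a ∷ m) f ≈ Ψ n m (topRow a f)
  Ψ-∷ {n} a m f = ≈-trans (∑-allStair n _) (∑-cong (allStair n) λ T → begin
    ∑ allLabels (λ x → ∑ (allVec n) (λ r → indicator (type (T ▷ (r ∷ʳ x)) ==W (a ∷ m))
      * (stairTerm (T ▷ (r ∷ʳ x)) * f (tops (T ▷ (r ∷ʳ x))))))
      ≈⟨ ∑-cong allLabels (λ x → ∑-cong (allVec n) (λ r → step T r x)) ⟩
    ∑ allLabels (λ x → ∑ (allVec n) (λ r → weight T * (gate (letterOf [] x ==L a) (diagTerm x)
      * (rowTerm x r (tops T) * (f ▸ x) (zipWith _<∣>_ r (tops T))))))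
      ≈⟨ ∑-cong allLabels (λ x → ≈-trans (∑-*ˡ (allVec n) (weight T) _) (*-congˡ
           (∑-*ˡ (allVec n) (gate (letterOf [] x ==L a) (diagTerm x))
                 (λ r → rowTerm x r (tops T) * (f ▸ x) (zipWith _<∣>_ r (tops T)))))) ⟩
    ∑ allLabels (λ x → weight T * (gate (letterOf [] x ==L a) (diagTerm x) * rowSum x (f ▸ x) (tops T)))
      ≈⟨ ∑-*ˡ allLabels (weight T) (λ x → gate (letterOf [] x ==L a) (diagTerm x) * rowSum x (f ▸ x) (tops T)) ⟩
    weight T * topRow a f (tops T)
      ≈⟨ *-assoc _ _ _ ⟩
    indicator (type T ==W m) * (stairTerm T * topRow a f (tops T)) ∎)
    where
    weight : Stair n → Carrier
    weight T = indicator (type T ==W m) * stairTerm T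
    indicator-∧ : ∀ b c x → indicator (b ∧ c) * x ≈ gate b x * indicator c
    indicator-∧ true  c x = solve 2 (λ i x → i :* x := x :* i) ≈-refl _ _
    indicator-∧ false c x = ≈-trans (zeroˡ _) (≈-sym (zeroˡ _))
    tops-▷ : ∀ (T : Stair n) r x → tops (T ▷ (r ∷ʳ x)) ≡ zipWith _<∣>_ r (tops T) ∷ʳ x
    tops-▷ T r x = trans (zipWith-∷ʳ _<∣>_ r (tops T) x nothing) (cong (_ ∷ʳ_) (<∣>-identityʳ x))
    step : ∀ T r x → indicator (type (T ▷ (r ∷ʳ x)) ==W (a ∷ m)) * (stairTerm (T ▷ (r ∷ʳ x)) * f (tops (T ▷ (r ∷ʳ x))))
      ≈ weight T * (gate (letterOf [] x ==L a) (diagTerm x) * (rowTerm x r (tops T) * (f ▸ x) (zipWith _<∣>_ r (tops T))))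
    step T r x = begin
      indicator (type (T ▷ (r ∷ʳ x)) ==W (a ∷ m)) * (stairTerm (T ▷ (r ∷ʳ x)) * f (tops (T ▷ (r ∷ʳ x))))
        ≈⟨ *-cong (reflexive (cong (λ t → indicator (t ==W (a ∷ m))) (type-▷ T r x)))
                  (*-cong (stairTerm-▷ T r x) (reflexive (cong f (tops-▷ T r x)))) ⟩
      indicator ((letterOf [] x ==L a) ∧ (type T ==W m)) * (stairTerm T * (diagTerm x * rowTerm x r (tops T)) * F)
        ≈⟨ solve 5 (λ i s d r f → i :* (s :* (d :* r) :* f) := i :* d :* (s :* (r :* f))) ≈-refl _ _ _ _ _ ⟩
      indicator ((letterOf [] x ==L a) ∧ (type T ==W m)) * diagTerm x * (stairTerm T * (rowTerm x r (tops T) * F))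
        ≈⟨ *-congʳ (indicator-∧ (letterOf [] x ==L a) (type T ==W m) (diagTerm x)) ⟩
      gate (letterOf [] x ==L a) (diagTerm x) * indicator (type T ==W m) * (stairTerm T * (rowTerm x r (tops T) * F))
        ≈⟨ solve 4 (λ d i s f → d :* i :* (s :* f) := i :* s :* (d :* f)) ≈-refl _ _ _ _ ⟩
      weight T * (gate (letterOf [] x ==L a) (diagTerm x) * (rowTerm x r (tops T) * F)) ∎
      where F = (f ▸ x) (zipWith _<∣>_ r (tops T))

  topRow-● : ∀ (f : Functional (suc n)) ss →
    topRow ● f ss ≈ α * openRow (f ▸ just Lα) ss ⊕ δ * (pow q n * (f ▸ just Lδ) ss)
  topRow-● f ss = ≈-trans
    (solve 7 (λ a d u x y z w → con 0 :* u :+ (a :* x :+ (con 0 :* y :+ (con 0 :* z :+ (d :* w :+ con 0)))) := a :* x :+ d :* w)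
      ≈-refl α δ _ _ _ _ _)
    (+-congˡ (*-congˡ (rowSum-δ (f ▸ just Lδ) ss)))

  -- `letterOf` sends an empty diagonal cell to ○, but `diagTerm nothing` is 0, so only γ and β
  -- contribute.
  topRow-○ : ∀ (f : Functional (suc n)) ss →
    topRow ○ f ss ≈ γ * openRow (f ▸ just Lγ) ss ⊕ β * (f ▸ just Lβ) ss
  topRow-○ f ss = ≈-trans
    (solve 7 (λ c b u x y z w → con 0 :* u :+ (con 0 :* x :+ (b :* y :+ (c :* z :+ (con 0 :* w :+ con 0)))) := c :* z :+ b :* y)
      ≈-refl γ β _ _ _ _ _)
    (+-cong (*-congˡ (rowSum-γ (f ▸ just Lγ) ss)) (*-congˡ (rowSum-β (f ▸ just Lβ) ss)))

  Ψ≈Φ : ∀ (X : Vec Letter n) f → Ψ n (toList X) f ≈ Φ X f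
  Ψ≈Φ [] f = ≈-trans (+-identityʳ _) (≈-trans (*-identityˡ _) (≈-trans (*-congʳ ≈-refl) (*-identityˡ _)))
  Ψ≈Φ {suc n} (● ∷ X) f = begin
    Ψ (suc n) (● ∷ toList X) f  ≈⟨ Ψ-∷ ● (toList X) f ⟩
    Ψ n (toList X) (topRow ● f) ≈⟨ Ψ≈Φ X _ ⟩
    Φ X (topRow ● f)            ≈⟨ Φ-cong X (topRow-● f) ⟩
    _                           ≈⟨ Φ-+ X _ _ ⟩
    _                           ≈⟨ +-cong (Φ-* X α _) (≈-trans (Φ-* X δ _) (*-congˡ (Φ-* X (pow q n) _))) ⟩
    Φ (● ∷ X) f                 ∎
  Ψ≈Φ {suc n} (○ ∷ X) f = begin
    Ψ (suc n) (○ ∷ toList X) f  ≈⟨ Ψ-∷ ○ (toList X) f ⟩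
    Ψ n (toList X) (topRow ○ f) ≈⟨ Ψ≈Φ X _ ⟩
    Φ X (topRow ○ f)            ≈⟨ Φ-cong X (topRow-○ f) ⟩
    _                           ≈⟨ Φ-+ X _ _ ⟩
    _                           ≈⟨ +-cong (Φ-* X γ _) (Φ-* X β _) ⟩
    Φ (○ ∷ X) f                 ∎

  tableauSum≈Ψ : ∀ n m → tableauSum n m ≈ Ψ n m (λ _ → 1#)
  tableauSum≈Ψ n m = ∑-cong (allStair n) λ T → term (isStaircase T) (type T ==W m) (wT T)
    where
    term : ∀ a b x → gate (a ∧ b) x ≈ indicator b * (gate a x * 1#)
    term true  true  x = ≈-sym (≈-trans (*-identityˡ _) (*-identityʳ x))
    term true  false x = ≈-sym (zeroˡ _)
    term false b     x = ≈-sym (≈-trans (*-congˡ (zeroˡ 1#)) (zeroʳ _))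

theorem9 : ∀ {c ℓ} (R : CommutativeRing c ℓ)
    (α β γ δ q : CommutativeRing.Carrier R)
    (n : ℕ) → 1 ≤ n → (m : Vec Letter n) →
    CommutativeRing._≈_ R (Weights.w R α β γ δ q (toList m))
    (Weights.tableauSum R α β γ δ q n (toList m))
theorem9 R α β γ δ q n _ m = begin
  wF (length (toList m)) (toList m)  ≡⟨ cong (λ k → wF k (toList m)) (length-toList m) ⟩
  wF n (toList m)                    ≈⟨ w≈Φ m ⟩
  Φ m (λ _ → 1#)                     ≈⟨ Ψ≈Φ m _ ⟨
  Ψ n (toList m) (λ _ → 1#)          ≈⟨ tableauSum≈Ψ n (toList m) ⟨
  tableauSum n (toList m)            ∎
  where
  open CommutativeRing R using (1#; setoid)
  open Weights R α β γ δ q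
  open Transfer R α β γ δ q
  open ≈-Reasoning setoid
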